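{- Let $n\geq 1$ and let $x=(x_1,\dots,x_n)\in B^n$ be such that every iterate $S^jx$, $j\geq0$, has strictly positive last coordinate and the expansion is eventually periodic: $S^{m+p}x=S^mx$ for some $m\geq0$, $p\geq1$. Let $k_j:=\lfloor 1/(S^{j-1}x)_n\rfloor$ and let the periodicity matrix be $\beta^{(p)}:=\beta(k_{m+1})\cdots\beta(k_{m+p})$. Let $\rho_0$ be the largest eigenvalue of $\beta^{(p)}$ (its spectral radius, a real positive eigenvalue since $\beta^{(p)}$ has nonnegative entries). Then $x_1,\dots,x_n$ are rational functions with rational coefficients of $\rho_0$; consequently $x_1,\dots,x_n$ lie in the number field $\mathbb{Q}(\rho_0)$, whose degree is at most $n+1$.
   Context: $B^n:=\{(x_1,\dots,x_n)\in\mathbb{R}^n:1\geq x_1\geq\dots\geq x_n\geq0\}$. The multiplicative Selmer algorithm is the map, defined for $x\in B^n$ with $x_n>0$, $S(x_1,\dots,x_n)=\left(\frac{x_2}{x_1},\dots,\frac{x_n}{x_1},\frac{1-kx_n}{x_1}\right)$ with $k=\lfloor x_n^{ -1}\rfloor$. For $k\in\mathbb{N}$, $\beta(k)$ is the $(n+1)\times(n+1)$ integer matrix (indices $0,\dots,n$) with entries $\beta(k)_{0,n-1}=k$, $\beta(k)_{0,n}=1$, $\beta(k)_{i,i-1}=1$ for $1\leq i\leq n$, and all other entries $0$. -}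

module Defs where

open import Algebra.Bundles.Raw using (RawMonoid)
import Algebra.Definitions.RawMonoid as RawMonoidOps
open import Data.Fin.Base using (Fin; zero; suc; toℕ; inject₁)
import Data.Fin.Properties as FinP
open import Data.Integer.Base as ℤ using (ℤ; +_)
open import Data.List.Base using (List; []; _∷_)
open import Data.Nat.Base as ℕ using (ℕ; zero; suc)
import Data.Nat.Properties as ℕP
open import Data.Product.Base using (Σ; Σ-syntax; ∃-syntax; _×_; _,_; proj₁; proj₂)
open import Data.Rational.Base as ℚ
  using (ℚ; 0ℚ; 1ℚ; ½; _+_; _*_; -_; _-_; ∣_∣; _⊔_; 1/_)
open import Data.Rational.Properties
open import Data.Rational.Solver using (module +-*-Solver)
open import Data.Sum.Base using (_⊎_; inj₁; inj₂)
open import Data.Vec.Functional using (Vector; head; tail; last)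
open import Data.Bool.Base using (if_then_else_)
open import Function.Base using (_∘_; case_of_)
open import Level using (0ℓ)
open import Relation.Nullary using (¬_; contradiction)
open import Relation.Nullary.Decidable.Core using (does)
open import Relation.Binary.PropositionalEquality
  using (_≡_; refl; sym; trans; cong; cong₂; subst; subst₂)

-- Real numbers: Cauchy sequences of rationals, with equality up to a
-- null sequence.

IsCauchy : (ℕ → ℚ) → Set
IsCauchy a = ∀ ε → 0ℚ ℚ.< ε →
  ∃[ N ] (∀ m n → N ℕ.≤ m → N ℕ.≤ n → ∣ a m - a n ∣ ℚ.< ε)

record ℝ : Set where
  constructor mkℝ
  field
    seq    : ℕ → ℚ
    cauchy : IsCauchy seq
open ℝ public

infix  4 _≈ℝ_ _<ℝ_ _≤ℝ_ _#ℝ_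
infixl 6 _+ℝ_ _-ℝ_
infixl 7 _*ℝ_
infix  8 -ℝ_

_≈ℝ_ : ℝ → ℝ → Set
x ≈ℝ y = ∀ ε → 0ℚ ℚ.< ε →
  ∃[ N ] (∀ n → N ℕ.≤ n → ∣ seq x n - seq y n ∣ ℚ.< ε)

_<ℝ_ : ℝ → ℝ → Set
x <ℝ y = ∃[ ε ] 0ℚ ℚ.< ε ×
  ∃[ N ] (∀ n → N ℕ.≤ n → seq x n + ε ℚ.≤ seq y n)

_≤ℝ_ : ℝ → ℝ → Set
x ≤ℝ y = ¬ (y <ℝ x)

-- "x ≠ y" in the positive sense that makes division by x - y possible.
_#ℝ_ : ℝ → ℝ → Set
x #ℝ y = x <ℝ y ⊎ y <ℝ x

module _ where
  open +-*-Solver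

  half+half : ∀ ε → ε * ½ + ε * ½ ≡ ε
  half+half ε = trans (sym (*-distribˡ-+ ε ½ ½)) (*-identityʳ ε)

  diff-+ : ∀ a b c d → (a + b) - (c + d) ≡ (a - c) + (b - d)
  diff-+ = solve 4
    (λ a b c d → (a :+ b) :- (c :+ d) := (a :- c) :+ (b :- d)) refl

  diff-* : ∀ a b c d → a * b - c * d ≡ a * (b - d) + d * (a - c)
  diff-* = solve 4
    (λ a b c d → a :* b :- c :* d := a :* (b :- d) :+ d :* (a :- c)) refl

  diff-neg : ∀ a b → (- a) - (- b) ≡ - (a - b)
  diff-neg = solve 2 (λ a b → (:- a) :- (:- b) := :- (a :- b)) refl

  split : ∀ a b → a ≡ (a - b) + b
  split = solve 2 (λ a b → a := (a :- b) :+ b) refl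

  diff-const : ∀ a → a - a ≡ 0ℚ
  diff-const = +-inverseʳ

  factor₁ : ∀ u v s t → s * (u * t) - t * (v * s) ≡ (s * t) * (u - v)
  factor₁ = solve 4 (λ u v s t →
    s :* (u :* t) :- t :* (v :* s) := (s :* t) :* (u :- v)) refl

  scale : ∀ K L ε → K * (ε * L) ≡ ε * (K * L)
  scale = solve 3 (λ K L ε → K :* (ε :* L) := ε :* (K :* L)) refl

pos-* : ∀ {a b} → 0ℚ ℚ.< a → 0ℚ ℚ.< b → 0ℚ ℚ.< a * b
pos-* {a} {b} 0<a 0<b =
  positive⁻¹ (a * b) {{pos*pos⇒pos a {{ℚ.positive 0<a}} b {{ℚ.positive 0<b}}}}

pos-½ : ∀ {ε} → 0ℚ ℚ.< ε → 0ℚ ℚ.< ε * ½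
pos-½ 0<ε = pos-* 0<ε (positive⁻¹ ½)

module _ {e : ℚ} (0<e : 0ℚ ℚ.< e) where
  inv : ℚ
  inv = (1/ e) {{ℚ.>-nonZero 0<e}}

  inv-pos : 0ℚ ℚ.< inv
  inv-pos = positive⁻¹ inv {{1/pos⇒pos e {{ℚ.positive 0<e}}}}

  inv-r : e * inv ≡ 1ℚ
  inv-r = *-inverseʳ e {{ℚ.>-nonZero 0<e}}

<-≤-pos : ∀ {e} → 0ℚ ℚ.< e → ∀ q → 0ℚ ℚ.< e ⊔ q
<-≤-pos {e} 0<e q = <-≤-trans 0<e (p≤p⊔q e q)

-- The terms are replaced by max(e, aₙ), with e a positive eventual lower
-- bound of a, so that every term can be inverted.
recip-seq : ∀ {e} → 0ℚ ℚ.< e → (ℕ → ℚ) → ℕ → ℚ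
recip-seq 0<e a n = inv (<-≤-pos 0<e (a n))

abstract
  mono-*ˡ : ∀ c {a b} → 0ℚ ℚ.≤ c → a ℚ.≤ b → c * a ℚ.≤ c * b
  mono-*ˡ c 0≤c = *-monoˡ-≤-nonNeg c {{ℚ.nonNegative 0≤c}}

  mono-*ʳ : ∀ c {a b} → 0ℚ ℚ.≤ c → a ℚ.≤ b → a * c ℚ.≤ b * c
  mono-*ʳ c 0≤c = *-monoʳ-≤-nonNeg c {{ℚ.nonNegative 0≤c}}

  mono-*< : ∀ c {a b} → 0ℚ ℚ.< c → a ℚ.< b → c * a ℚ.< c * b
  mono-*< c 0<c = *-monoʳ-<-pos c {{ℚ.positive 0<c}}

  -- An eventual bound for the absolute values of a Cauchy sequence.
  bounded : (x : ℝ) → ∃[ K ] 0ℚ ℚ.< K ×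
            ∃[ N ] (∀ n → N ℕ.≤ n → ∣ seq x n ∣ ℚ.≤ K)
  bounded x with cauchy x 1ℚ (positive⁻¹ 1ℚ)
  ... | N , close = K , 0<K , N , bd
    where
    K : ℚ
    K = 1ℚ + ∣ seq x N ∣
    0<K : 0ℚ ℚ.< K
    0<K = <-≤-trans (positive⁻¹ 1ℚ)
            (subst (ℚ._≤ K) (+-identityʳ 1ℚ) (+-monoʳ-≤ 1ℚ (0≤∣p∣ (seq x N))))
    bd : ∀ n → N ℕ.≤ n → ∣ seq x n ∣ ℚ.≤ K
    bd n N≤n = ≤-trans
      (subst (λ z → ∣ z ∣ ℚ.≤ ∣ seq x n - seq x N ∣ + ∣ seq x N ∣)
        (sym (split (seq x n) (seq x N)))
        (∣p+q∣≤∣p∣+∣q∣ (seq x n - seq x N) (seq x N)))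
      (+-monoˡ-≤ ∣ seq x N ∣ (<⇒≤ (close n N N≤n ℕP.≤-refl)))

  const-cauchy : ∀ q → IsCauchy (λ _ → q)
  const-cauchy q ε 0<ε =
    0 , λ _ _ _ _ → subst (λ z → ∣ z ∣ ℚ.< ε) (sym (diff-const q)) 0<ε

  +-cauchy : ∀ x y → IsCauchy (λ n → seq x n + seq y n)
  +-cauchy x y ε 0<ε
    with cauchy x (ε * ½) (pos-½ 0<ε) | cauchy y (ε * ½) (pos-½ 0<ε)
  ... | N₁ , c₁ | N₂ , c₂ = N₁ ℕ.⊔ N₂ , λ m n N≤m N≤n →
    subst₂ ℚ._<_ (cong ∣_∣ (sym (diff-+ (seq x m) (seq y m) (seq x n) (seq y n))))
      (half+half ε)
      (≤-<-trans (∣p+q∣≤∣p∣+∣q∣ (seq x m - seq x n) (seq y m - seq y n))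
        (+-mono-<
          (c₁ m n (ℕP.m⊔n≤o⇒m≤o N₁ N₂ N≤m) (ℕP.m⊔n≤o⇒m≤o N₁ N₂ N≤n))
          (c₂ m n (ℕP.m⊔n≤o⇒n≤o N₁ N₂ N≤m) (ℕP.m⊔n≤o⇒n≤o N₁ N₂ N≤n))))

  neg-cauchy : ∀ x → IsCauchy (λ n → - seq x n)
  neg-cauchy x ε 0<ε with cauchy x ε 0<ε
  ... | N , c = N , λ m n N≤m N≤n →
    subst (ℚ._< ε)
      (sym (trans (cong ∣_∣ (diff-neg (seq x m) (seq x n)))
                  (∣-p∣≡∣p∣ (seq x m - seq x n))))
      (c m n N≤m N≤n)

  -- ∣ s ∣ ≤ K and ∣ t ∣ < ε / K give ∣ s t ∣ < ε.
  small-* : ∀ {K} (0<K : 0ℚ ℚ.< K) {ε s t} →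
            ∣ s ∣ ℚ.≤ K → ∣ t ∣ ℚ.< ε * inv 0<K → ∣ s * t ∣ ℚ.< ε
  small-* {K} 0<K {ε} {s} {t} s≤K t<ε =
    subst₂ ℚ._<_ (sym (∣p*q∣≡∣p∣*∣q∣ s t))
      (trans (scale K (inv 0<K) ε)
             (trans (cong (ε *_) (inv-r 0<K)) (*-identityʳ ε)))
      (≤-<-trans (mono-*ʳ ∣ t ∣ (0≤∣p∣ t) s≤K) (mono-*< K 0<K t<ε))

  close-* : ∀ {A B} (0<A : 0ℚ ℚ.< A) (0<B : 0ℚ ℚ.< B) a b c d ε →
            ∣ a ∣ ℚ.≤ A → ∣ d ∣ ℚ.≤ B →
            ∣ b - d ∣ ℚ.< ε * ½ * inv 0<A → ∣ a - c ∣ ℚ.< ε * ½ * inv 0<B →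
            ∣ a * b - c * d ∣ ℚ.< ε
  close-* 0<A 0<B a b c d ε a≤A d≤B hb ha =
    subst₂ ℚ._<_ (cong ∣_∣ (sym (diff-* a b c d))) (half+half ε)
      (≤-<-trans (∣p+q∣≤∣p∣+∣q∣ (a * (b - d)) (d * (a - c)))
        (+-mono-< (small-* 0<A {ε * ½} {a} {b - d} a≤A hb)
                  (small-* 0<B {ε * ½} {d} {a - c} d≤B ha)))

  *-cauchy : ∀ x y → IsCauchy (λ n → seq x n * seq y n)
  *-cauchy x y ε 0<ε =
    let A , 0<A , M₁ , bx = bounded x
        B , 0<B , M₂ , by = bounded y
        N₁ , c₁ = cauchy x (ε * ½ * inv 0<B) (pos-* (pos-½ 0<ε) (inv-pos 0<B))
        N₂ , c₂ = cauchy y (ε * ½ * inv 0<A) (pos-* (pos-½ 0<ε) (inv-pos 0<A))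
        M≤ : ∀ {m} → (M₁ ℕ.⊔ M₂) ℕ.⊔ (N₁ ℕ.⊔ N₂) ℕ.≤ m → M₁ ℕ.⊔ M₂ ℕ.≤ m
        M≤ = ℕP.m⊔n≤o⇒m≤o (M₁ ℕ.⊔ M₂) (N₁ ℕ.⊔ N₂)
        N≤ : ∀ {m} → (M₁ ℕ.⊔ M₂) ℕ.⊔ (N₁ ℕ.⊔ N₂) ℕ.≤ m → N₁ ℕ.⊔ N₂ ℕ.≤ m
        N≤ = ℕP.m⊔n≤o⇒n≤o (M₁ ℕ.⊔ M₂) (N₁ ℕ.⊔ N₂)
    in (M₁ ℕ.⊔ M₂) ℕ.⊔ (N₁ ℕ.⊔ N₂) , λ m n hm hn →
      close-* 0<A 0<B (seq x m) (seq y m) (seq x n) (seq y n) ε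
        (bx m (ℕP.m⊔n≤o⇒m≤o M₁ M₂ (M≤ hm)))
        (by n (ℕP.m⊔n≤o⇒n≤o M₁ M₂ (M≤ hn)))
        (c₂ m n (ℕP.m⊔n≤o⇒n≤o N₁ N₂ (N≤ hm)) (ℕP.m⊔n≤o⇒n≤o N₁ N₂ (N≤ hn)))
        (c₁ m n (ℕP.m⊔n≤o⇒m≤o N₁ N₂ (N≤ hm)) (ℕP.m⊔n≤o⇒m≤o N₁ N₂ (N≤ hn)))

  inv-diff : ∀ {u v} (0<u : 0ℚ ℚ.< u) (0<v : 0ℚ ℚ.< v) →
             inv 0<u - inv 0<v ≡ (inv 0<u * inv 0<v) * (v - u)
  inv-diff {u} {v} 0<u 0<v =
    trans (cong₂ _-_
            (sym (trans (cong (inv 0<u *_) (inv-r 0<v)) (*-identityʳ (inv 0<u))))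
            (sym (trans (cong (inv 0<v *_) (inv-r 0<u)) (*-identityʳ (inv 0<v)))))
          (factor₁ v u (inv 0<u) (inv 0<v))

  inv-anti : ∀ {u v} (0<u : 0ℚ ℚ.< u) (0<v : 0ℚ ℚ.< v) →
             u ℚ.≤ v → inv 0<v ℚ.≤ inv 0<u
  inv-anti {u} {v} 0<u 0<v u≤v =
    subst₂ ℚ._≤_
      (trans (*-assoc (inv 0<v) u (inv 0<u))
        (trans (cong (inv 0<v *_) (inv-r 0<u)) (*-identityʳ (inv 0<v))))
      (trans (cong (_* inv 0<u) (trans (*-comm (inv 0<v) v) (inv-r 0<v)))
        (*-identityˡ (inv 0<u)))
      (mono-*ʳ (inv 0<u) (<⇒≤ (inv-pos 0<u))
        (mono-*ˡ (inv 0<v) (<⇒≤ (inv-pos 0<v)) u≤v))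

  recip-cauchy : ∀ x {e} (0<e : 0ℚ ℚ.< e) (N₀ : ℕ) →
                 (∀ n → N₀ ℕ.≤ n → 0ℚ + e ℚ.≤ seq x n) →
                 IsCauchy (recip-seq 0<e (seq x))
  recip-cauchy x {e} 0<e N₀ e≤x ε 0<ε
    = N₀ ℕ.⊔ N₁ , close
    where
    a I : ℕ → ℚ
    a = seq x
    I = recip-seq 0<e a
    0<E : 0ℚ ℚ.< inv 0<e * inv 0<e
    0<E = pos-* (inv-pos 0<e) (inv-pos 0<e)
    modulus : ∃[ N ] (∀ m n → N ℕ.≤ m → N ℕ.≤ n →
                      ∣ a m - a n ∣ ℚ.< ε * inv 0<E)
    modulus = cauchy x (ε * inv 0<E) (pos-* 0<ε (inv-pos 0<E))
    N₁ : ℕ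
    N₁ = proj₁ modulus
    c : ∀ m n → N₁ ℕ.≤ m → N₁ ℕ.≤ n → ∣ a m - a n ∣ ℚ.< ε * inv 0<E
    c = proj₂ modulus
    I-pos : ∀ n → 0ℚ ℚ.< I n
    I-pos n = inv-pos (<-≤-pos 0<e (a n))
    I≤ : ∀ n → I n ℚ.≤ inv 0<e
    I≤ n = inv-anti 0<e (<-≤-pos 0<e (a n)) (p≤p⊔q e (a n))
    max-eq : ∀ n → N₀ ℕ.≤ n → e ⊔ a n ≡ a n
    max-eq n h = p≤q⇒p⊔q≡q (subst (ℚ._≤ a n) (+-identityˡ e) (e≤x n h))
    bound : ∀ m n → ∣ I m * I n ∣ ℚ.≤ inv 0<e * inv 0<e
    bound m n = subst (ℚ._≤ inv 0<e * inv 0<e)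
      (sym (0≤p⇒∣p∣≡p (<⇒≤ (pos-* (I-pos m) (I-pos n)))))
      (≤-trans (mono-*ʳ (I n) (<⇒≤ (I-pos n)) (I≤ m))
               (mono-*ˡ (inv 0<e) (<⇒≤ (inv-pos 0<e)) (I≤ n)))
    close : ∀ m n → N₀ ℕ.⊔ N₁ ℕ.≤ m → N₀ ℕ.⊔ N₁ ℕ.≤ n → ∣ I m - I n ∣ ℚ.< ε
    close m n hm hn =
      subst (λ z → ∣ z ∣ ℚ.< ε)
        (sym (trans (inv-diff (<-≤-pos 0<e (a m)) (<-≤-pos 0<e (a n)))
          (cong ((I m * I n) *_)
            (cong₂ _-_ (max-eq n (ℕP.m⊔n≤o⇒m≤o N₀ N₁ hn))
                       (max-eq m (ℕP.m⊔n≤o⇒m≤o N₀ N₁ hm))))))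
        (small-* 0<E (bound m n)
          (c n m (ℕP.m⊔n≤o⇒n≤o N₀ N₁ hn) (ℕP.m⊔n≤o⇒n≤o N₀ N₁ hm)))

  neg-pos-swap : ∀ {a e} → a + e ℚ.≤ 0ℚ → 0ℚ + e ℚ.≤ - a
  neg-pos-swap {a} {e} h =
    subst₂ ℚ._≤_ (solve 2 (λ a e → :- a :+ (a :+ e) := con 0ℚ :+ e) refl a e)
      (+-identityʳ (- a)) (+-monoʳ-≤ (- a) h)
    where open +-*-Solver

  p≤∣p∣ : ∀ p → p ℚ.≤ ∣ p ∣
  p≤∣p∣ p = case ≤-total 0ℚ p of λ where
    (inj₁ 0≤p) → ≤-reflexive (sym (0≤p⇒∣p∣≡p 0≤p))
    (inj₂ p≤0) → ≤-trans p≤0 (0≤∣p∣ p)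

  near : ∀ a b q → ∣ a - b ∣ ℚ.< q → a ℚ.< q + b
  near a b q h = subst (ℚ._< q + b) (sym (split a b))
    (+-monoˡ-< b (≤-<-trans (p≤∣p∣ (a - b)) h))

fromℚ : ℚ → ℝ
fromℚ q = mkℝ (λ _ → q) (const-cauchy q)

fromℤ : ℤ → ℝ
fromℤ i = fromℚ (i ℚ./ 1)

fromNat : ℕ → ℝ
fromNat k = fromℤ (+ k)

0ℝ 1ℝ : ℝ
0ℝ = fromℚ 0ℚ
1ℝ = fromℚ 1ℚ

_+ℝ_ : ℝ → ℝ → ℝ
x +ℝ y = mkℝ (λ n → seq x n + seq y n) (+-cauchy x y)

-ℝ_ : ℝ → ℝ
-ℝ x = mkℝ (λ n → - seq x n) (neg-cauchy x)

_-ℝ_ : ℝ → ℝ → ℝ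
x -ℝ y = x +ℝ (-ℝ y)

_*ℝ_ : ℝ → ℝ → ℝ
x *ℝ y = mkℝ (λ n → seq x n * seq y n) (*-cauchy x y)

recip-pos : (x : ℝ) → 0ℝ <ℝ x → ℝ
recip-pos x (e , 0<e , N , e≤x) =
  mkℝ (recip-seq 0<e (seq x)) (recip-cauchy x 0<e N e≤x)

recip : (x : ℝ) → x #ℝ 0ℝ → ℝ
recip x (inj₂ 0<x)                 = recip-pos x 0<x
recip x (inj₁ (e , 0<e , N , x<0)) =
  -ℝ recip-pos (-ℝ x) (e , 0<e , N , λ n N≤n → neg-pos-swap (x<0 n N≤n))

divℝ : (x y : ℝ) → y #ℝ 0ℝ → ℝ
divℝ x y y#0 = x *ℝ recip y y#0

syntax divℝ x y y#0 = x ÷ℝ y [ y#0 ]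

+ℝ-rawMonoid : RawMonoid 0ℓ 0ℓ
+ℝ-rawMonoid = record { Carrier = ℝ ; _≈_ = _≈ℝ_ ; _∙_ = _+ℝ_ ; ε = 0ℝ }

sumℝ : ∀ {d} → Vector ℝ d → ℝ
sumℝ = RawMonoidOps.sum +ℝ-rawMonoid

abstract
  <ℝ-≤ℝ-pos : ∀ x y → 0ℝ <ℝ x → x ≤ℝ y → 0ℝ <ℝ y
  <ℝ-≤ℝ-pos x y (e , 0<e , N₁ , e≤x) x≤y = decide (≤-total (seq y M) h)
    where
    h q : ℚ
    h = e * ½
    q = h * ½
    0<q : 0ℚ ℚ.< q
    0<q = pos-½ (pos-½ 0<e)
    N₂ M : ℕ
    N₂ = proj₁ (cauchy y q 0<q)
    M = N₁ ℕ.⊔ N₂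
    close : ∀ m n → N₂ ℕ.≤ m → N₂ ℕ.≤ n → ∣ seq y m - seq y n ∣ ℚ.< q
    close = proj₂ (cauchy y q 0<q)
    rearrange₁ : ∀ q h → (q + h) + q ≡ (q + q) + h
    rearrange₁ = solve 2 (λ q h → (q :+ h) :+ q := (q :+ q) :+ h) refl
      where open +-*-Solver
    quarters : (q + h) + q ≡ 0ℚ + e
    quarters = trans (rearrange₁ q h)
      (trans (cong (_+ h) (half+half h))
        (trans (half+half e) (sym (+-identityˡ e))))
    y<x : seq y M ℚ.≤ h → ∀ n → M ℕ.≤ n → seq y n + q ℚ.≤ seq x n
    y<x yM≤h n M≤n = ≤-trans
      (+-monoˡ-≤ q (≤-trans
        (<⇒≤ (near (seq y n) (seq y M) q
          (close n M (ℕP.m⊔n≤o⇒n≤o N₁ N₂ M≤n) (ℕP.m≤n⊔m N₁ N₂))))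
        (+-monoʳ-≤ q yM≤h)))
      (subst (ℚ._≤ seq x n) (sym quarters)
        (e≤x n (ℕP.m⊔n≤o⇒m≤o N₁ N₂ M≤n)))
    cancel : ∀ q z → - q + (q + z) ≡ z
    cancel = solve 2 (λ q z → :- q :+ (q :+ z) := z) refl
      where open +-*-Solver
    0<y : h ℚ.≤ seq y M → ∀ n → M ℕ.≤ n → 0ℚ + q ℚ.≤ seq y n
    0<y h≤yM n M≤n = subst₂ ℚ._≤_
      (trans (cong (λ z → - q + z) (sym (half+half h)))
        (trans (cancel q q) (sym (+-identityˡ q))))
      (cancel q (seq y n))
      (+-monoʳ-≤ (- q) (≤-trans h≤yM
        (<⇒≤ (near (seq y M) (seq y n) q
          (close M n (ℕP.m≤n⊔m N₁ N₂) (ℕP.m⊔n≤o⇒n≤o N₁ N₂ M≤n))))))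
    decide : seq y M ℚ.≤ h ⊎ h ℚ.≤ seq y M → 0ℝ <ℝ y
    decide (inj₁ yM≤h) = contradiction (q , 0<q , M , y<x yM≤h) x≤y
    decide (inj₂ h≤yM) = q , 0<q , M , 0<y h≤yM

  head-pos-chain : ∀ {r} (x : Vector ℝ (suc r)) →
    (∀ (i : Fin r) → x (suc i) ≤ℝ x (inject₁ i)) →
    0ℝ <ℝ last x → 0ℝ <ℝ head x
  head-pos-chain {zero}  x dec pos = pos
  head-pos-chain {suc r} x dec pos =
    <ℝ-≤ℝ-pos (x (suc zero)) (x zero)
      (head-pos-chain (tail x) (dec ∘ suc) pos) (dec zero)

-- The multiplicative Selmer algorithm. Throughout n = suc r, so that
-- n ≥ 1, and the coordinates x₁, …, xₙ are indexed by 0, …, r.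

record B (r : ℕ) : Set where
  field
    pt         : Vector ℝ (suc r)
    head≤1     : head pt ≤ℝ 1ℝ
    decreasing : ∀ (i : Fin r) → pt (suc i) ≤ℝ pt (inject₁ i)
    0≤last     : 0ℝ ≤ℝ last pt
open B public

head-pos : ∀ {r} (x : B r) → 0ℝ <ℝ last (pt x) → 0ℝ <ℝ head (pt x)
head-pos x = head-pos-chain (pt x) (decreasing x)

snoc : ∀ {A : Set} {d} → Vector A d → A → Vector A (suc d)
snoc {d = zero}  v a _       = a
snoc {d = suc d} v a zero    = head v
snoc {d = suc d} v a (suc i) = snoc (tail v) a i

-- The digit k = ⌊ 1 / xₙ ⌋ is an argument because the floor of a real
-- number is not computable; see digit-floor below.
S : ∀ {r} (x : B r) → 0ℝ <ℝ last (pt x) → (k : ℕ) → Vector ℝ (suc r)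
S x pos k i =
  snoc (tail (pt x)) (1ℝ -ℝ fromNat k *ℝ last (pt x)) i
    ÷ℝ head (pt x) [ inj₂ (head-pos x pos) ]

IsFloor : ℕ → ℝ → Set
IsFloor k x = fromNat k ≤ℝ x × x <ℝ fromNat (suc k)

_≈ᵛ_ : ∀ {d} → Vector ℝ d → Vector ℝ d → Set
v ≈ᵛ w = ∀ i → v i ≈ℝ w i

-- The infinite orbit of x, all of whose points have positive last
-- coordinate: iter j is Sʲ x, and digit j is k_j for j ≥ 1 (digit 0 is
-- irrelevant). Sʲ x belongs to Bⁿ automatically for j ≥ 1, since S maps its
-- domain into Bⁿ.
record Expansion {r : ℕ} (x : B r) : Set where
  field
    iter        : ℕ → B r
    start       : pt (iter 0) ≈ᵛ pt x
    positive    : ∀ j → 0ℝ <ℝ last (pt (iter j))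
    digit       : ℕ → ℕ
    digit-floor : ∀ j → IsFloor (digit (suc j))
                    (1ℝ ÷ℝ last (pt (iter j)) [ inj₂ (positive j) ])
    step        : ∀ j → pt (iter (suc j)) ≈ᵛ
                    S (iter j) (positive j) (digit (suc j))
open Expansion public

Matrix : Set → ℕ → Set
Matrix A d = Vector (Vector A d) d

sumℤ : ∀ {d} → Vector ℤ d → ℤ
sumℤ = RawMonoidOps.sum ℤ.+-0-rawMonoid

identity : ∀ {d} → Matrix ℤ d
identity i j = if does (i FinP.≟ j) then + 1 else + 0

infixl 7 _⊗_
_⊗_ : ∀ {d} → Matrix ℤ d → Matrix ℤ d → Matrix ℤ d
(M ⊗ N) i j = sumℤ λ l → M i l ℤ.* N l j

-- Rows and columns are indexed by 0, …, n with n = suc r.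
β : ∀ {r} → ℕ → Matrix ℤ (suc (suc r))
β {r} k zero j =
  if does (toℕ j ℕP.≟ r) then + k else
  if does (toℕ j ℕP.≟ suc r) then + 1 else + 0
β {r} k (suc i) j =
  if does (toℕ j ℕP.≟ toℕ i) then + 1 else + 0

-- β(k_{m+1}) ⋯ β(k_{m+p})
periodMatrix : ∀ {r} → (ℕ → ℕ) → (m p : ℕ) → Matrix ℤ (suc (suc r))
periodMatrix k m zero    = identity
periodMatrix k m (suc p) = periodMatrix k m p ⊗ β (k (m ℕ.+ suc p))

record ℂ : Set where
  constructor _+i_
  field
    re im : ℝ
open ℂ public

infix  4 _≈ℂ_
infixl 6 _+ℂ_
infixl 7 _*ℂ_

_≈ℂ_ : ℂ → ℂ → Set
z ≈ℂ w = re z ≈ℝ re w × im z ≈ℝ im w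

_+ℂ_ : ℂ → ℂ → ℂ
z +ℂ w = (re z +ℝ re w) +i (im z +ℝ im w)

_*ℂ_ : ℂ → ℂ → ℂ
z *ℂ w = (re z *ℝ re w -ℝ im z *ℝ im w) +i (re z *ℝ im w +ℝ im z *ℝ re w)

fromℝ : ℝ → ℂ
fromℝ x = x +i 0ℝ

-- z ≠ 0
NonZeroℂ : ℂ → Set
NonZeroℂ z = re z #ℝ 0ℝ ⊎ im z #ℝ 0ℝ

∣_∣² : ℂ → ℝ
∣ z ∣² = re z *ℝ re z +ℝ im z *ℝ im z

sumℂ : ∀ {d} → Vector ℂ d → ℂ
sumℂ = RawMonoidOps.sum
  (record { Carrier = ℂ ; _≈_ = _≈ℂ_ ; _∙_ = _+ℂ_ ; ε = fromℝ 0ℝ })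

_·_ : ∀ {d} → Matrix ℤ d → Vector ℂ d → Vector ℂ d
(M · v) i = sumℂ λ j → fromℝ (fromℤ (M i j)) *ℂ v j

IsEigenvalue : ∀ {d} → Matrix ℤ d → ℂ → Set
IsEigenvalue {d} M μ =
  Σ[ v ∈ Vector ℂ d ] (∃[ i ] NonZeroℂ (v i)) × (∀ i → (M · v) i ≈ℂ μ *ℂ v i)

-- ρ = max { ∣ μ ∣ : μ a complex eigenvalue of M }. Since ρ ≥ 0, moduli are
-- compared with ρ through their squares.
IsSpectralRadius : ∀ {d} → Matrix ℤ d → ℝ → Set
IsSpectralRadius M ρ =
  0ℝ ≤ℝ ρ ×
  (∀ μ → IsEigenvalue M μ → ∣ μ ∣² ≤ℝ ρ *ℝ ρ) ×
  (∃[ μ ] IsEigenvalue M μ × ∣ μ ∣² ≈ℝ ρ *ℝ ρ)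

-- Coefficients are listed from the constant term upwards.
eval : List ℚ → ℝ → ℝ
eval []      ρ = 0ℝ
eval (c ∷ P) ρ = fromℚ c +ℝ ρ *ℝ eval P ρ

IsRationalFunctionOf : ℝ → ℝ → Set
IsRationalFunctionOf ρ y =
  ∃[ P ] ∃[ Q ] Σ[ Q#0 ∈ eval Q ρ #ℝ 0ℝ ] y ≈ℝ (eval P ρ ÷ℝ eval Q ρ [ Q#0 ])

-- The smallest subfield of ℝ containing ρ.
data ℚ⟨_⟩ (ρ : ℝ) : ℝ → Set where
  resp : ∀ {y z} → y ≈ℝ z → ℚ⟨ ρ ⟩ y → ℚ⟨ ρ ⟩ z
  rat  : ∀ q → ℚ⟨ ρ ⟩ (fromℚ q)
  gen  : ℚ⟨ ρ ⟩ ρ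
  add  : ∀ {y z} → ℚ⟨ ρ ⟩ y → ℚ⟨ ρ ⟩ z → ℚ⟨ ρ ⟩ (y +ℝ z)
  neg  : ∀ {y} → ℚ⟨ ρ ⟩ y → ℚ⟨ ρ ⟩ (-ℝ y)
  mul  : ∀ {y z} → ℚ⟨ ρ ⟩ y → ℚ⟨ ρ ⟩ z → ℚ⟨ ρ ⟩ (y *ℝ z)
  inv# : ∀ {y} (y#0 : y #ℝ 0ℝ) → ℚ⟨ ρ ⟩ y → ℚ⟨ ρ ⟩ (recip y y#0)

combination : ∀ {d} → Vector ℚ d → Vector ℝ d → ℝ
combination q b = sumℝ λ i → fromℚ (q i) *ℝ b i

-- b is a family of elements of ℚ(ρ) spanning it as a vector space over ℚ.
Spans : ∀ {d} → ℝ → Vector ℝ d → Set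
Spans {d} ρ b =
  (∀ i → ℚ⟨ ρ ⟩ (b i)) ×
  (∀ y → ℚ⟨ ρ ⟩ y → Σ[ q ∈ Vector ℚ d ] y ≈ℝ combination q b)

LinearlyIndependent : ∀ {d} → Vector ℝ d → Set
LinearlyIndependent {d} b =
  ∀ (q : Vector ℚ d) → combination q b ≈ℝ 0ℝ → ∀ i → q i ≡ 0ℚ

-- [ℚ(ρ) : ℚ] = d
HasDegree : ℝ → ℕ → Set
HasDegree ρ d = Σ[ b ∈ Vector ℝ d ] Spans ρ b × LinearlyIndependent b

-- [ℚ(ρ) : ℚ] ≤ N. Extracting a basis from a spanning family requires
-- deciding linear dependence over ℚ, so finiteness of the extension is
-- expressed by a spanning family of N elements.
DegreeAtMost : ℝ → ℕ → Set
DegreeAtMost ρ N =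
  (Σ[ b ∈ Vector ℝ N ] Spans ρ b) × (∀ d → HasDegree ρ d → d ℕ.≤ N)

-- Put w = (1, y) with y = Sᵐ x. The relation y₁ · β(k) (1, S y) = (1, y),
-- iterated over one period, gives βᵖ w = ρ w with w > 0 and ρ > 0, and a
-- nonnegative matrix with a positive eigenvector has the corresponding
-- eigenvalue as its spectral radius. Some power of βᵖ has a positive
-- column 0; setting w₀ = 1 in its eigenvector equation leaves a system
-- z = b + C z with b > 0 and C ≥ 0, which can be eliminated over ℚ(ρ)
-- without a vanishing pivot, so w ∈ ℚ(ρ)ⁿ⁺¹, and the backward steps carry this
-- from Sᵐ x to x.
--
-- For the degree, let V be the ℚ-span of w. Since ρ V ⊆ V, multiplication by
-- any element of ℚ[ρ] maps V to itself. If z V ⊆ V then the powers of z lie in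
-- V ∋ 1, so they are linearly dependent over ℚ and 1 / z is a polynomial in z.
-- Hence ℚ(ρ) = ℚ[ρ] ⊆ V, and V has at most n + 1 dimensions.

module Submission where

open import Algebra.Bundles using (CommutativeRing)
import Algebra.Properties.Ring as RingProperties
import Algebra.Properties.Semiring.Sum as SemiringSum
import Algebra.Solver.Ring as RingSolver
open import Algebra.Solver.Ring.AlmostCommutativeRing
  using (_-Raw-AlmostCommutative⟶_; Induced-equivalence; fromCommutativeRing)
open import Data.Bool.Base using (true; false; if_then_else_)
open import Data.Fin.Base using (Fin; zero; suc; toℕ; fromℕ; inject₁; punchIn; punchOut)
import Data.Fin.Properties as FinP
open import Data.Integer.Base as ℤ using (ℤ; +_)
import Data.Integer.Properties as ℤP
open import Data.List.Base as List using (List; []; _∷_)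
open import Data.Maybe.Base using (map)
open import Data.Nat.Base as ℕ using (ℕ; zero; suc)
import Data.Nat.Properties as ℕP
import Data.Nat.Solver as ℕSolver
open import Data.Product.Base using (Σ-syntax; ∃-syntax; _×_; _,_; proj₁; proj₂)
open import Data.Rational.Base as ℚ using (ℚ; 0ℚ; 1ℚ; ½)
import Data.Rational.Properties as ℚP
import Data.Rational.Solver as ℚSolver
import Data.Rational.Unnormalised.Base as ℚᵘ
import Data.Rational.Unnormalised.Properties as ℚᵘP
open import Data.Sum.Base using (_⊎_; inj₁; inj₂)
open import Data.Vec.Functional using (Vector; head; tail; last) renaming (_∷_ to _∷ᵛ_)
open import Function.Base using (_∘_)
open import Level using (0ℓ)
open import Relation.Binary.Definitions using (Decidable; WeaklyDecidable)
open import Relation.Binary.PropositionalEquality as ≡ using (_≡_; _≢_)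
import Relation.Binary.Reasoning.Setoid as SetoidReasoning
open import Relation.Nullary using (¬_; Dec; contradiction; yes; no; ¬?; does)
open import Relation.Nullary.Decidable using (dec⇒maybe; dec-true; dec-false; decidable-stable)
open import Defs

-- The reals are Cauchy sequences, so neither their equality nor their order is decidable, and this
-- shapes the whole argument. Cramer's rule or a rank count would have to know which minors of
-- `βᵖ - ρ` vanish; strict positivity takes their place, because every pivot that is divided by is
-- known to be positive. The positive column has a combinatorial origin: in the graph of β(k) with k
-- ≥ 1 the vertex 0 lies on cycles of the consecutive lengths n and n + 1, so walks to 0 from all
-- vertices can be padded to one common length. The digits are at least 1 because the last
-- coordinate is at most 1. Linear dependence is only ever decided for coordinate vectors over ℚ,
-- and no minimal polynomial of ρ is computed.

-- Linear dependence over a field with decidable equality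

module LinearDependence (R : CommutativeRing 0ℓ 0ℓ)
  (_≟_ : Decidable (CommutativeRing._≈_ R))
  (invertible : ∀ x → ¬ CommutativeRing._≈_ R x (CommutativeRing.0# R) →
    ∃[ y ] CommutativeRing._≈_ R (CommutativeRing._*_ R y x) (CommutativeRing.1# R)) where
  open CommutativeRing R hiding (zero)
  open SemiringSum semiring
    using (sum; sum-cong-≋; sum-replicate-zero; ∑-distrib-+; *-distribʳ-sum)
  open SetoidReasoning setoid
  open RingProperties ring using (-‿distribˡ-*)

  -- Gaussian elimination with the first vector as pivot row. If it vanishes, it is itself a
  -- relation. Otherwise a nonzero coordinate `j₀` of it is cleared from the other vectors, which
  -- then form a smaller instance without that coordinate; the coefficient of the pivot row collects
  -- the multiples that were subtracted.
  linearly-dependent : ∀ {N d} → N ℕ.< d → 0# ≉ 1# →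
    (u : Fin d → Vector Carrier N) →
    Σ[ q ∈ Vector Carrier d ] (∃[ i ] q i ≉ 0#) × (∀ j → sum (λ i → q i * u i j) ≈ 0#)
  linearly-dependent {N} {suc d} N<d 0≉1 u with FinP.any? (λ j → ¬? (u zero j ≟ 0#))
  linearly-dependent {N} {suc d} N<d 0≉1 u | no u₀≈0 =
    (1# ∷ᵛ λ _ → 0#) , (zero , λ 1≈0 → 0≉1 (sym 1≈0)) , λ j → begin
      1# * u zero j + sum (λ i → 0# * u (suc i) j)
        ≈⟨ +-cong (*-identityˡ _) (sum-cong-≋ (λ i → zeroˡ (u (suc i) j))) ⟩
      u zero j + sum {d} (λ _ → 0#)
        ≈⟨ +-cong (decidable-stable (u zero j ≟ 0#) (λ u≉0 → u₀≈0 (j , u≉0)))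
             (sum-replicate-zero d) ⟩
      0# + 0#
        ≈⟨ +-identityˡ 0# ⟩
      0# ∎
  linearly-dependent {suc N} {suc d} N<d 0≉1 u | yes (j₀ , pivot≉0) =
    (sum (λ i → q i * - c i) ∷ᵛ q) , (suc (proj₁ nontrivial) , proj₂ nontrivial) ,
    λ j → begin
      sum (λ i → q i * - c i) * u zero j + sum (λ i → q i * u (suc i) j)
        ≈⟨ +-congʳ (*-distribʳ-sum (u zero j) (λ i → q i * - c i)) ⟩
      sum (λ i → q i * - c i * u zero j) + sum (λ i → q i * u (suc i) j)
        ≈⟨ ∑-distrib-+ (λ i → q i * - c i * u zero j) (λ i → q i * u (suc i) j) ⟨
      sum (λ i → q i * - c i * u zero j + q i * u (suc i) j)
        ≈⟨ sum-cong-≋ (λ i → trans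
             (+-congʳ (trans (*-assoc (q i) (- c i) (u zero j))
               (*-congˡ (sym (-‿distribˡ-* (c i) (u zero j))))))
             (trans (sym (distribˡ (q i) _ _)) (*-congˡ (+-comm _ _)))) ⟩
      sum (λ i → q i * reduced i j)
        ≈⟨ relation j (j₀ FinP.≟ j) ⟩
      0# ∎
    where
    pivot⁻¹ : Carrier
    pivot⁻¹ = proj₁ (invertible (u zero j₀) pivot≉0)
    c : Vector Carrier d
    c i = u (suc i) j₀ * pivot⁻¹
    reduced : Fin d → Vector Carrier (suc N)
    reduced i j = u (suc i) j - c i * u zero j
    reduced-j₀ : ∀ i → reduced i j₀ ≈ 0#
    reduced-j₀ i = begin
      u (suc i) j₀ - u (suc i) j₀ * pivot⁻¹ * u zero j₀
        ≈⟨ +-congˡ (-‿cong (trans (*-assoc _ _ _)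
             (trans (*-congˡ (proj₂ (invertible (u zero j₀) pivot≉0))) (*-identityʳ _)))) ⟩
      u (suc i) j₀ - u (suc i) j₀
        ≈⟨ -‿inverseʳ _ ⟩
      0# ∎
    ih : Σ[ q ∈ Vector Carrier d ] (∃[ i ] q i ≉ 0#) ×
         (∀ j → sum (λ i → q i * reduced i (punchIn j₀ j)) ≈ 0#)
    ih = linearly-dependent (ℕ.s<s⁻¹ N<d) 0≉1 (λ i j → reduced i (punchIn j₀ j))
    q : Vector Carrier d
    q = proj₁ ih
    nontrivial : ∃[ i ] q i ≉ 0#
    nontrivial = proj₁ (proj₂ ih)
    relation : ∀ j → Dec (j₀ ≡ j) → sum (λ i → q i * reduced i j) ≈ 0#
    relation j (yes ≡.refl) = trans
      (sum-cong-≋ (λ i → trans (*-congˡ (reduced-j₀ i)) (zeroʳ (q i))))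
      (sum-replicate-zero d)
    relation j (no j₀≢j) = ≡.subst (λ j → sum (λ i → q i * reduced i j) ≈ 0#)
      (FinP.punchIn-punchOut j₀≢j) (proj₂ (proj₂ ih) (punchOut j₀≢j))

ℚ-invertible : ∀ p → p ≢ 0ℚ → ∃[ q ] q ℚ.* p ≡ 1ℚ
ℚ-invertible p p≢0 = (ℚ.1/ p) {{ℚ.≢-nonZero p≢0}} , ℚP.*-inverseˡ p {{ℚ.≢-nonZero p≢0}}

open LinearDependence ℚP.+-*-commutativeRing ℚP._≟_ ℚ-invertible

-- Ordered fields with undecidable order

-- Strict positivity is the primitive notion and weak inequality its negation. `pos-cotrans` is the
-- constructive substitute for trichotomy, and `tight` recovers equality from two refuted
-- inequalities. The algebra below is stated over this interface and so never sees a Cauchy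
-- sequence.
record OrderedFieldOverℚ : Set₁ where
  field
    commutativeRing : CommutativeRing 0ℓ 0ℓ
  open CommutativeRing commutativeRing public hiding (zero)
  field
    ι           : ℚ → Carrier
    ι-+         : ∀ p q → ι (p ℚ.+ q) ≈ ι p + ι q
    ι-*         : ∀ p q → ι (p ℚ.* q) ≈ ι p * ι q
    ι-neg       : ∀ p → ι (ℚ.- p) ≈ - ι p
    ι-0         : ι 0ℚ ≈ 0#
    ι-1         : ι 1ℚ ≈ 1#
    Pos         : Carrier → Set
    pos-resp    : ∀ {x y} → x ≈ y → Pos x → Pos y
    ¬pos-0      : ¬ Pos 0#
    pos-1       : Pos 1#
    +-pos       : ∀ {x y} → Pos x → Pos y → Pos (x + y)
    *-pos       : ∀ {x y} → Pos x → Pos y → Pos (x * y)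
    pos-cotrans : ∀ x y → Pos (x + y) → Pos x ⊎ Pos y
    tight       : ∀ {x} → ¬ Pos x → ¬ Pos (- x) → x ≈ 0#
    inverse     : ∀ {x} → Pos x → ∃[ y ] Pos y × x * y ≈ 1#

module OrderedField (F : OrderedFieldOverℚ) where
  open OrderedFieldOverℚ F
  open SemiringSum semiring public
    using (sum; sum-cong-≋; sum-replicate-zero; sum-init-last; ∑-distrib-+; ∑-comm;
           *-distribˡ-sum; *-distribʳ-sum)
  open import Algebra.Properties.Semiring.Exp semiring public using (_^_)
  open RingProperties ring using (-‿distribˡ-*; -‿distribʳ-*; -0#≈0#)
  module ≈-Reasoning = SetoidReasoning setoid
  open ≈-Reasoning

  private
    ι-morphism : CommutativeRing.rawRing ℚP.+-*-commutativeRing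
                   -Raw-AlmostCommutative⟶ fromCommutativeRing commutativeRing
    ι-morphism = record { ⟦_⟧ = ι ; +-homo = ι-+ ; *-homo = ι-* ; -‿homo = ι-neg
                        ; 0-homo = ι-0 ; 1-homo = ι-1 }

    ι-weaklyDecidable : WeaklyDecidable (Induced-equivalence ι-morphism)
    ι-weaklyDecidable p q = map (λ p≡q → reflexive (≡.cong ι p≡q)) (dec⇒maybe (p ℚP.≟ q))

  open RingSolver (CommutativeRing.rawRing ℚP.+-*-commutativeRing)
    (fromCommutativeRing commutativeRing) ι-morphism ι-weaklyDecidable
    public using (solve; _:=_; _:+_; _:*_; _:-_; :-_)

  Nonneg : Carrier → Set
  Nonneg x = ¬ Pos (- x)

  nonneg-resp : ∀ {x y} → x ≈ y → Nonneg x → Nonneg y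
  nonneg-resp x≈y x≥0 = x≥0 ∘ pos-resp (-‿cong (sym x≈y))

  ¬pos⇒nonneg : ∀ {x y} → ¬ Pos (x - y) → Nonneg (y - x)
  ¬pos⇒nonneg {x} {y} ¬p =
    ¬p ∘ pos-resp (solve 2 (λ x y → :- (y :- x) := x :- y) refl x y)

  pos⇒nonneg : ∀ {x} → Pos x → Nonneg x
  pos⇒nonneg {x} x>0 x<0 = ¬pos-0 (pos-resp (-‿inverseʳ x) (+-pos x>0 x<0))

  nonneg-0 : Nonneg 0#
  nonneg-0 = ¬pos-0 ∘ pos-resp -0#≈0#

  -- Cotransitivity on `x = (x + y) + (- y)`, whose second summand cannot be positive.
  pos+nonneg : ∀ {x y} → Pos x → Nonneg y → Pos (x + y)
  pos+nonneg {x} {y} x>0 y≥0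
    with pos-cotrans (x + y) (- y)
           (pos-resp (solve 2 (λ x y → x := (x :+ y) :- y) refl x y) x>0)
  ... | inj₁ x+y>0 = x+y>0
  ... | inj₂ y<0   = contradiction y<0 y≥0

  nonneg+nonneg : ∀ {x y} → Nonneg x → Nonneg y → Nonneg (x + y)
  nonneg+nonneg {x} {y} x≥0 y≥0 x+y<0
    with pos-cotrans (- x) (- y)
           (pos-resp (solve 2 (λ x y → :- (x :+ y) := :- x :+ :- y) refl x y) x+y<0)
  ... | inj₁ x<0 = x≥0 x<0
  ... | inj₂ y<0 = y≥0 y<0

  pos-cancelʳ : ∀ {x y} → Pos (x * y) → Pos y → Pos x
  pos-cancelʳ {x} {y} xy>0 y>0 =
    let y⁻¹ , y⁻¹>0 , yy⁻¹≈1 = inverse y>0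
    in pos-resp (trans (*-assoc x y y⁻¹) (trans (*-congˡ yy⁻¹≈1) (*-identityʳ x)))
         (*-pos xy>0 y⁻¹>0)

  nonneg-cancelʳ : ∀ {x y} → Nonneg (x * y) → Pos y → Nonneg x
  nonneg-cancelʳ {x} {y} xy≥0 y>0 x<0 =
    xy≥0 (pos-resp (sym (-‿distribˡ-* x y)) (*-pos x<0 y>0))

  -- No case distinction on the sign of `x` is available. Instead, if `x * y` were negative, then
  -- `x` could not be positive, since cancelling it would make `y` negative; hence `x ≈ 0#` by
  -- `tight`, and the product is zero.
  nonneg*nonneg : ∀ {x y} → Nonneg x → Nonneg y → Nonneg (x * y)
  nonneg*nonneg {x} {y} x≥0 y≥0 xy<0 =
    ¬pos-0 (pos-resp (trans (-‿cong (trans (*-congʳ x≈0) (zeroˡ y))) -0#≈0#) xy<0)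
    where
    x≈0 : x ≈ 0#
    x≈0 = tight
      (λ x>0 → y≥0 (pos-cancelʳ
        (pos-resp (trans (-‿distribʳ-* x y) (*-comm x (- y))) xy<0) x>0))
      x≥0

  nonneg-square : ∀ x → Nonneg (x * x)
  nonneg-square x x²<0 =
    ¬pos-0 (pos-resp (trans (-‿cong (trans (*-congʳ x≈0) (zeroˡ x))) -0#≈0#) x²<0)
    where
    x≈0 : x ≈ 0#
    x≈0 = tight
      (λ x>0 → pos⇒nonneg (*-pos x>0 x>0) x²<0)
      (λ x<0 → pos⇒nonneg
        (pos-resp (solve 1 (λ x → (:- x) :* (:- x) := x :* x) refl x) (*-pos x<0 x<0)) x²<0)

  nonneg-sum : ∀ {d} {t : Vector Carrier d} → (∀ i → Nonneg (t i)) → Nonneg (sum t)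
  nonneg-sum {zero}  t≥0 = nonneg-0
  nonneg-sum {suc d} t≥0 = nonneg+nonneg (t≥0 zero) (nonneg-sum (t≥0 ∘ suc))

  -- If `x > y`, then `x² - y² = (x - y) ((x - y) + 2 y)` is positive. The sign of `x` is left open,
  -- as the cross term of `norm²-triangle` requires.
  square-reflects-≤ : ∀ {x y} → Nonneg y → Nonneg (y * y - x * x) → Nonneg (y - x)
  square-reflects-≤ {x} {y} y≥0 x²≤y² x>y =
    x²≤y² (pos-resp
      (solve 2 (λ x y → (:- (y :- x)) :* (:- (y :- x) :+ (y :+ y))
                          := :- (y :* y :- x :* x)) refl x y)
      (*-pos x>y (pos+nonneg x>y (nonneg+nonneg y≥0 y≥0))))

  squares-equal : ∀ {x y} → Pos x → Nonneg y →
                  Nonneg (y * y - x * x) → Nonneg (x * x - y * y) → x ≈ y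
  squares-equal {x} {y} x>0 y≥0 x²≤y² y²≤x² = begin
    x              ≈⟨ solve 2 (λ x y → x := (x :- y) :+ y) refl x y ⟩
    (x - y) + y    ≈⟨ +-congʳ (tight (square-reflects-≤ y≥0 x²≤y² ∘ flip′)
                        (square-reflects-≤ (pos⇒nonneg x>0) y²≤x²)) ⟩
    0# + y         ≈⟨ +-identityˡ y ⟩
    y              ∎
    where
    flip′ : Pos (x - y) → Pos (- (y - x))
    flip′ = pos-resp (solve 2 (λ x y → x :- y := :- (y :- x)) refl x y)

  -- Choosing the larger of two elements is not constructive, hence the double negation. It costs
  -- nothing in `eigenvalue-bound`, whose conclusion is a weak inequality and so itself a negation.
  ¬¬maximum : ∀ {d} (t : Vector Carrier (suc d)) →
              ¬ ¬ (∃[ m ] ∀ i → Nonneg (t m - t i))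
  ¬¬maximum {zero} t ¬max =
    ¬max (zero , λ { zero → nonneg-resp (sym (-‿inverseʳ (t zero))) nonneg-0 })
  ¬¬maximum {suc d} t ¬max = ¬¬maximum (t ∘ suc) λ where
    (m , max) →
      let ¬t₀>tₘ : ¬ Pos (t zero - t (suc m))
          ¬t₀>tₘ t₀>tₘ = ¬max (zero , λ where
            zero    → nonneg-resp (sym (-‿inverseʳ (t zero))) nonneg-0
            (suc i) → nonneg-resp
              (solve 3 (λ a b c → (a :- b) :+ (b :- c) := a :- c) refl
                (t zero) (t (suc m)) (t (suc i)))
              (nonneg+nonneg (pos⇒nonneg t₀>tₘ) (max i)))
      in ¬max (suc m , λ { zero → ¬pos⇒nonneg ¬t₀>tₘ ; (suc i) → max i })

  -- Eigenvalues of nonnegative matrices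

  norm² : Carrier → Carrier → Carrier
  norm² x y = x * x + y * y

  norm²-cong : ∀ {x x′ y y′} → x ≈ x′ → y ≈ y′ → norm² x y ≈ norm² x′ y′
  norm²-cong x≈ y≈ = +-cong (*-cong x≈ x≈) (*-cong y≈ y≈)

  nonneg-norm² : ∀ x y → Nonneg (norm² x y)
  nonneg-norm² x y = nonneg+nonneg (nonneg-square x) (nonneg-square y)

  -- The cross term x x′ + y y′ is at most C s s′ because its square is
  -- at most |x + i y|² |x′ + i y′|².
  norm²-triangle : ∀ {C s s′ x y x′ y′} → Nonneg C → Nonneg s → Nonneg s′ →
    Nonneg (C * (s * s) - norm² x y) → Nonneg (C * (s′ * s′) - norm² x′ y′) →
    Nonneg (C * ((s + s′) * (s + s′)) - norm² (x + x′) (y + y′))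
  norm²-triangle {C} {s} {s′} {x} {y} {x′} {y′} C≥0 s≥0 s′≥0 le le′ =
    nonneg-resp
      (solve 7 (λ C s s′ x y x′ y′ →
        (C :* (s :* s) :- (x :* x :+ y :* y)) :+ (C :* (s′ :* s′) :- (x′ :* x′ :+ y′ :* y′))
          :+ ((C :* (s :* s′) :- (x :* x′ :+ y :* y′)) :+ (C :* (s :* s′) :- (x :* x′ :+ y :* y′)))
        := C :* ((s :+ s′) :* (s :+ s′)) :- ((x :+ x′) :* (x :+ x′) :+ (y :+ y′) :* (y :+ y′)))
        refl C s s′ x y x′ y′)
      (nonneg+nonneg (nonneg+nonneg le le′) (nonneg+nonneg cross cross))
    where
    cross : Nonneg (C * (s * s′) - (x * x′ + y * y′))
    -- Lagrange's identity: `∣z∣² ∣z′∣² - (x x′ + y y′)² = (x y′ - x′ y)²`, together with the two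
    -- hypotheses multiplied out.
    cross = square-reflects-≤ (nonneg*nonneg C≥0 (nonneg*nonneg s≥0 s′≥0))
      (nonneg-resp
        (solve 7 (λ C s s′ x y x′ y′ →
          (C :* (s :* s) :- (x :* x :+ y :* y)) :* (C :* (s′ :* s′))
            :+ ((x :* x :+ y :* y) :* (C :* (s′ :* s′) :- (x′ :* x′ :+ y′ :* y′))
            :+ (x :* y′ :- x′ :* y) :* (x :* y′ :- x′ :* y))
          := C :* (s :* s′) :* (C :* (s :* s′)) :- (x :* x′ :+ y :* y′) :* (x :* x′ :+ y :* y′))
          refl C s s′ x y x′ y′)
        (nonneg+nonneg (nonneg*nonneg le (nonneg*nonneg C≥0 (nonneg-square s′)))
          (nonneg+nonneg (nonneg*nonneg (nonneg-norm² x y) le′)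
            (nonneg-square (x * y′ - x′ * y)))))

  -- A weighted triangle inequality, kept in squares to avoid square roots: `C` is the square of a
  -- common bound for ∣zⱼ∣ / wⱼ, where zⱼ = uⱼ + i vⱼ. Each summand is absorbed by `norm²-triangle`.
  norm²-sum : ∀ {d C} {a w u v : Vector Carrier d} → Nonneg C →
    (∀ j → Nonneg (a j)) → (∀ j → Nonneg (w j)) →
    (∀ j → Nonneg (C * (w j * w j) - norm² (u j) (v j))) →
    let s = sum (λ j → a j * w j) in
    Nonneg (C * (s * s) - norm² (sum (λ j → a j * u j)) (sum (λ j → a j * v j)))
  norm²-sum {zero} {C} C≥0 a≥0 w≥0 le =
    nonneg-resp (sym (trans
      (+-cong (trans (*-congˡ (zeroˡ 0#)) (zeroʳ C))
        (-‿cong (trans (+-cong (zeroˡ 0#) (zeroˡ 0#)) (+-identityˡ 0#))))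
      (-‿inverseʳ 0#))) nonneg-0
  norm²-sum {suc d} {C} {a} {w} {u} {v} C≥0 a≥0 w≥0 le =
    norm²-triangle C≥0 (nonneg*nonneg (a≥0 zero) (w≥0 zero))
      (nonneg-sum (λ j → nonneg*nonneg (a≥0 (suc j)) (w≥0 (suc j))))
      (nonneg-resp
        (solve 5 (λ C a w u v →
          (a :* a) :* (C :* (w :* w) :- (u :* u :+ v :* v))
          := C :* (a :* w :* (a :* w)) :- (a :* u :* (a :* u) :+ a :* v :* (a :* v)))
          refl C (a zero) (w zero) (u zero) (v zero))
        (nonneg*nonneg (nonneg-square (a zero)) (le zero)))
      (norm²-sum C≥0 (a≥0 ∘ suc) (w≥0 ∘ suc) (le ∘ suc))

  -- x + i y is an eigenvalue of A with eigenvector u + i v, and ∣ u + i v ∣ / w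
  -- is compared with its maximum.
  eigenvalue-bound : ∀ {d} {A : Fin d → Fin d → Carrier} {w : Vector Carrier d} {ρ} →
    (∀ i j → Nonneg (A i j)) → (∀ i → Pos (w i)) →
    (∀ i → sum (λ j → A i j * w j) ≈ ρ * w i) →
    ∀ {x y} {u v : Vector Carrier d} →
    (∀ i → sum (λ j → A i j * u j) ≈ x * u i - y * v i) →
    (∀ i → sum (λ j → A i j * v j) ≈ x * v i + y * u i) →
    (∃[ i ] Pos (norm² (u i) (v i))) → Nonneg (ρ * ρ - norm² x y)
  eigenvalue-bound {suc d} {A} {w} {ρ} A≥0 w>0 Aw {x} {y} {u} {v} Au Av (i₀ , v₀>0) μ>ρ =
    ¬¬maximum t λ where
      (m , max) →
        let tₘ>0 : Pos (t m)
            tₘ>0 = pos-resp (solve 2 (λ a b → a :+ (b :- a) := b) refl (t i₀) (t m))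
                     (pos+nonneg (*-pos v₀>0 (*-pos (w⁻¹>0 i₀) (w⁻¹>0 i₀))) (max i₀))
            bound : ∀ j → Nonneg (t m * (w j * w j) - norm² (u j) (v j))
            bound j = nonneg-resp
              (trans (solve 3 (λ a b c → (a :- b) :* c := a :* c :- b :* c) refl (t m) (t j) (w j * w j))
                (+-congˡ (-‿cong (t*w² j))))
              (nonneg*nonneg (max j) (nonneg-square (w j)))
            vₘ>0 : Pos (norm² (u m) (v m))
            vₘ>0 = pos-resp (t*w² m) (*-pos tₘ>0 (*-pos (w>0 m) (w>0 m)))
            total : Nonneg (t m * (ρ * w m * (ρ * w m))
                      - norm² (x * u m - y * v m) (x * v m + y * u m))
            total = nonneg-resp
              (+-cong (*-congˡ (*-cong (Aw m) (Aw m))) (-‿cong (norm²-cong (Au m) (Av m))))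
              (norm²-sum (pos⇒nonneg tₘ>0) (A≥0 m) (pos⇒nonneg ∘ w>0) bound)
        -- Row `m` says `t m (ρ wₘ)² ≥ ∣μ zₘ∣²` with `t m * wₘ² = ∣zₘ∣²`, so `∣zₘ∣²` is a common
        -- factor; it is positive because `t m` is at least `t i₀`.
        in nonneg-cancelʳ (nonneg-resp (regroup m) total) vₘ>0 μ>ρ
    where
    w⁻¹ : Vector Carrier (suc d)
    w⁻¹ i = proj₁ (inverse (w>0 i))
    w⁻¹>0 : ∀ i → Pos (w⁻¹ i)
    w⁻¹>0 i = proj₁ (proj₂ (inverse (w>0 i)))
    t : Vector Carrier (suc d)
    t i = norm² (u i) (v i) * (w⁻¹ i * w⁻¹ i)
    t*w² : ∀ i → t i * (w i * w i) ≈ norm² (u i) (v i)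
    t*w² i = begin
      t i * (w i * w i)
        ≈⟨ solve 3 (λ n w w′ → n :* (w′ :* w′) :* (w :* w) := n :* ((w :* w′) :* (w :* w′)))
             refl (norm² (u i) (v i)) (w i) (w⁻¹ i) ⟩
      norm² (u i) (v i) * ((w i * w⁻¹ i) * (w i * w⁻¹ i))
        ≈⟨ *-congˡ (*-cong ww⁻¹ ww⁻¹) ⟩
      norm² (u i) (v i) * (1# * 1#)
        ≈⟨ trans (*-congˡ (*-identityʳ 1#)) (*-identityʳ _) ⟩
      norm² (u i) (v i) ∎
      where
      ww⁻¹ : w i * w⁻¹ i ≈ 1#
      ww⁻¹ = proj₂ (proj₂ (inverse (w>0 i)))
    regroup : ∀ m → t m * (ρ * w m * (ρ * w m)) - norm² (x * u m - y * v m) (x * v m + y * u m)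
              ≈ (ρ * ρ - norm² x y) * norm² (u m) (v m)
    regroup m = begin
      t m * (ρ * w m * (ρ * w m)) - norm² (x * u m - y * v m) (x * v m + y * u m)
        ≈⟨ solve 7 (λ t w ρ x y u v →
             t :* (ρ :* w :* (ρ :* w)) :- ((x :* u :- y :* v) :* (x :* u :- y :* v)
               :+ (x :* v :+ y :* u) :* (x :* v :+ y :* u))
             := ρ :* ρ :* (t :* (w :* w)) :- (x :* x :+ y :* y) :* (u :* u :+ v :* v))
             refl (t m) (w m) ρ x y (u m) (v m) ⟩
      ρ * ρ * (t m * (w m * w m)) - norm² x y * norm² (u m) (v m)
        ≈⟨ +-congʳ (*-congˡ (t*w² m)) ⟩
      ρ * ρ * norm² (u m) (v m) - norm² x y * norm² (u m) (v m)
        ≈⟨ solve 3 (λ a b c → a :* c :- b :* c := (a :- b) :* c) refl (ρ * ρ) (norm² x y) (norm² (u m) (v m)) ⟩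
      (ρ * ρ - norm² x y) * norm² (u m) (v m) ∎

  -- Subfields

  record IsSubring (K : Carrier → Set) : Set where
    field
      K-resp : ∀ {x y} → x ≈ y → K x → K y
      K-ι    : ∀ q → K (ι q)
      K-+    : ∀ {x y} → K x → K y → K (x + y)
      K-neg  : ∀ {x} → K x → K (- x)
      K-*    : ∀ {x y} → K x → K y → K (x * y)

    K-0 : K 0#
    K-0 = K-resp ι-0 (K-ι 0ℚ)

    K-1 : K 1#
    K-1 = K-resp ι-1 (K-ι 1ℚ)

    K-sum : ∀ {d} {t : Vector Carrier d} → (∀ i → K (t i)) → K (sum t)
    K-sum {zero}  t∈K = K-0
    K-sum {suc d} t∈K = K-+ (t∈K zero) (K-sum (t∈K ∘ suc))

    K-^ : ∀ {x} → K x → ∀ n → K (x ^ n)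
    K-^ x∈K zero    = K-1
    K-^ x∈K (suc n) = K-* x∈K (K-^ x∈K n)

  -- Inverses are asked for positive elements only: these are the ones the ordered field inverts,
  -- and the elimination divides by nothing else.
  record IsSubfield (K : Carrier → Set) : Set where
    field
      isSubring : IsSubring K
      K-inv     : ∀ {x y} → Pos x → x * y ≈ 1# → K x → K y
    open IsSubring isSubring public

  module _ {K : Carrier → Set} (subfield : IsSubfield K) where
    open IsSubfield subfield

    -- Eliminating z₀ by (1 - C₀₀) z₀ = b₀ + Σ C₀ⱼ zⱼ > 0 gives a system of
    -- the same shape, so no pivot can vanish.
    positive-solution : ∀ {d} {C : Fin d → Fin d → Carrier} {b z : Vector Carrier d} →
      (∀ i j → K (C i j)) → (∀ i → K (b i)) →
      (∀ i j → Nonneg (C i j)) → (∀ i → Pos (b i)) → (∀ i → Pos (z i)) →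
      (∀ i → z i ≈ b i + sum (λ j → C i j * z j)) → ∀ i → K (z i)
    positive-solution {suc d} {C} {b} {z} C∈K b∈K C≥0 b>0 z>0 eq = solution
      where
      T : Carrier
      T = sum (λ j → C zero (suc j) * z (suc j))
      T≥0 : Nonneg T
      T≥0 = nonneg-sum (λ j → nonneg*nonneg (C≥0 zero (suc j)) (pos⇒nonneg (z>0 (suc j))))
      pivot-eq : (1# - C zero zero) * z zero ≈ b zero + T
      pivot-eq = begin
        (1# - C zero zero) * z zero
          ≈⟨ solve 3 (λ e c z → (e :- c) :* z := e :* z :- c :* z) refl 1# (C zero zero) (z zero) ⟩
        1# * z zero - C zero zero * z zero
          ≈⟨ +-congʳ (trans (*-identityˡ _) (eq zero)) ⟩
        b zero + (C zero zero * z zero + T) - C zero zero * z zero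
          ≈⟨ solve 3 (λ b c t → b :+ (c :+ t) :- c := b :+ t) refl (b zero) (C zero zero * z zero) T ⟩
        b zero + T ∎
      pivot>0 : Pos (1# - C zero zero)
      pivot>0 = pos-cancelʳ (pos-resp (sym pivot-eq) (pos+nonneg (b>0 zero) T≥0)) (z>0 zero)
      s : Carrier
      s = proj₁ (inverse pivot>0)
      s>0 : Pos s
      s>0 = proj₁ (proj₂ (inverse pivot>0))
      ps≈1 : (1# - C zero zero) * s ≈ 1#
      ps≈1 = proj₂ (proj₂ (inverse pivot>0))
      s∈K : K s
      s∈K = K-inv pivot>0 ps≈1 (K-+ K-1 (K-neg (C∈K zero zero)))
      z₀ : z zero ≈ s * (b zero + T)
      z₀ = begin
        z zero                              ≈⟨ *-identityˡ _ ⟨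
        1# * z zero                         ≈⟨ *-congʳ ps≈1 ⟨
        (1# - C zero zero) * s * z zero     ≈⟨ solve 3 (λ p s z → p :* s :* z := s :* (p :* z)) refl _ s (z zero) ⟩
        s * ((1# - C zero zero) * z zero)   ≈⟨ *-congˡ pivot-eq ⟩
        s * (b zero + T)                    ∎
      C′ : Fin d → Fin d → Carrier
      C′ i j = C (suc i) (suc j) + C (suc i) zero * s * C zero (suc j)
      b′ : Vector Carrier d
      b′ i = b (suc i) + C (suc i) zero * s * b zero
      eq′ : ∀ i → z (suc i) ≈ b′ i + sum (λ j → C′ i j * z (suc j))
      eq′ i = begin
        z (suc i)
          ≈⟨ eq (suc i) ⟩
        b (suc i) + (C (suc i) zero * z zero + U)
          ≈⟨ +-congˡ (+-congʳ (*-congˡ z₀)) ⟩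
        b (suc i) + (C (suc i) zero * (s * (b zero + T)) + U)
          ≈⟨ solve 6 (λ b c s b₀ t u →
               b :+ (c :* (s :* (b₀ :+ t)) :+ u) := b :+ c :* s :* b₀ :+ (u :+ c :* s :* t))
               refl (b (suc i)) (C (suc i) zero) s (b zero) T U ⟩
        b′ i + (U + C (suc i) zero * s * T)
          ≈⟨ +-congˡ (+-congˡ (*-distribˡ-sum (C (suc i) zero * s) (λ j → C zero (suc j) * z (suc j)))) ⟩
        b′ i + (U + sum (λ j → C (suc i) zero * s * (C zero (suc j) * z (suc j))))
          ≈⟨ +-congˡ (∑-distrib-+ (λ j → C (suc i) (suc j) * z (suc j))
                 (λ j → C (suc i) zero * s * (C zero (suc j) * z (suc j)))) ⟨
        b′ i + sum (λ j → C (suc i) (suc j) * z (suc j)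
                          + C (suc i) zero * s * (C zero (suc j) * z (suc j)))
          ≈⟨ +-congˡ (sum-cong-≋ (λ j → solve 4 (λ c k e z → c :* z :+ k :* (e :* z) := (c :+ k :* e) :* z)
               refl (C (suc i) (suc j)) (C (suc i) zero * s) (C zero (suc j)) (z (suc j)))) ⟩
        b′ i + sum (λ j → C′ i j * z (suc j)) ∎
        where
        U : Carrier
        U = sum (λ j → C (suc i) (suc j) * z (suc j))
      tail-solution : ∀ i → K (z (suc i))
      tail-solution = positive-solution {C = C′} {b′}
        (λ i j → K-+ (C∈K (suc i) (suc j)) (K-* (K-* (C∈K (suc i) zero) s∈K) (C∈K zero (suc j))))
        (λ i → K-+ (b∈K (suc i)) (K-* (K-* (C∈K (suc i) zero) s∈K) (b∈K zero)))
        (λ i j → nonneg+nonneg (C≥0 (suc i) (suc j))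
          (nonneg*nonneg (nonneg*nonneg (C≥0 (suc i) zero) (pos⇒nonneg s>0)) (C≥0 zero (suc j))))
        (λ i → pos+nonneg (b>0 (suc i))
          (nonneg*nonneg (nonneg*nonneg (C≥0 (suc i) zero) (pos⇒nonneg s>0)) (pos⇒nonneg (b>0 zero))))
        (z>0 ∘ suc) eq′
      solution : ∀ i → K (z i)
      solution zero = K-resp (sym z₀)
        (K-* s∈K (K-+ (b∈K zero) (K-sum (λ j → K-* (C∈K zero (suc j)) (tail-solution j)))))
      solution (suc i) = tail-solution i

-- Spans over ℚ and the ring of their multipliers

module RationalSpans (F : OrderedFieldOverℚ) where
  open OrderedFieldOverℚ F
  open OrderedField F
  open ≈-Reasoning
  open RingProperties ring using (-‿distribˡ-*; -0#≈0#)

  linearCombination : ∀ {d} → Vector ℚ d → Vector Carrier d → Carrier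
  linearCombination q w = sum (λ i → ι (q i) * w i)

  InSpan : ∀ {d} → Vector Carrier d → Carrier → Set
  InSpan w y = ∃[ q ] y ≈ linearCombination q w

  ι-sum : ∀ {d} (q : Vector ℚ d) →
    ι (SemiringSum.sum (CommutativeRing.semiring ℚP.+-*-commutativeRing) q) ≈ sum (ι ∘ q)
  ι-sum {zero}  q = ι-0
  ι-sum {suc d} q = trans (ι-+ _ _) (+-congˡ (ι-sum (q ∘ suc)))

  module _ {N} {w : Vector Carrier N} where

    span-resp : ∀ {x y} → x ≈ y → InSpan w x → InSpan w y
    span-resp x≈y (q , eq) = q , trans (sym x≈y) eq

    span-0 : InSpan w 0#
    span-0 = (λ _ → 0ℚ) , sym (trans
      (sum-cong-≋ (λ i → trans (*-congʳ ι-0) (zeroˡ (w i)))) (sum-replicate-zero N))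

    span-+ : ∀ {x y} → InSpan w x → InSpan w y → InSpan w (x + y)
    span-+ {x} {y} (p , x≈) (q , y≈) = (λ i → p i ℚ.+ q i) , (begin
      x + y
        ≈⟨ +-cong x≈ y≈ ⟩
      linearCombination p w + linearCombination q w
        ≈⟨ ∑-distrib-+ (λ i → ι (p i) * w i) (λ i → ι (q i) * w i) ⟨
      sum (λ i → ι (p i) * w i + ι (q i) * w i)
        ≈⟨ sum-cong-≋ (λ i → trans (sym (distribʳ (w i) _ _)) (*-congʳ (sym (ι-+ (p i) (q i))))) ⟩
      linearCombination (λ i → p i ℚ.+ q i) w ∎)

    span-scale : ∀ c {x} → InSpan w x → InSpan w (ι c * x)
    span-scale c {x} (q , x≈) = (λ i → c ℚ.* q i) , (begin
      ι c * x
        ≈⟨ *-congˡ x≈ ⟩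
      ι c * linearCombination q w
        ≈⟨ *-distribˡ-sum (ι c) (λ i → ι (q i) * w i) ⟩
      sum (λ i → ι c * (ι (q i) * w i))
        ≈⟨ sum-cong-≋ (λ i → trans (sym (*-assoc _ _ _)) (*-congʳ (sym (ι-* c (q i))))) ⟩
      linearCombination (λ i → c ℚ.* q i) w ∎)

    span-sum : ∀ {d} (q : Vector ℚ d) {z : Vector Carrier d} →
                       (∀ i → InSpan w (z i)) → InSpan w (linearCombination q z)
    span-sum {zero}  q z∈V = span-0
    span-sum {suc d} q z∈V =
      span-+ (span-scale (q zero) (z∈V zero)) (span-sum (q ∘ suc) (z∈V ∘ suc))

    -- The elimination runs on the rational coordinates of the `b i`, where zero can be recognised.
    -- A relation between the coordinate rows becomes one between the `b i` on exchanging the two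
    -- sums, whether or not `w` is independent.
    spanned-dependent : ∀ {d} → N ℕ.< d → (b : Vector Carrier d) → (∀ i → InSpan w (b i)) →
      Σ[ c ∈ Vector ℚ d ] (∃[ i ] c i ≢ 0ℚ) × linearCombination c b ≈ 0#
    spanned-dependent N<d b b∈V = c , proj₁ (proj₂ dep) , (begin
      sum (λ i → ι (c i) * b i)
        ≈⟨ sum-cong-≋ (λ i → trans (*-congˡ (proj₂ (b∈V i)))
             (trans (*-distribˡ-sum (ι (c i)) (λ j → ι (q i j) * w j))
               (sum-cong-≋ (λ j → trans (sym (*-assoc _ _ _)) (*-congʳ (sym (ι-* (c i) (q i j)))))))) ⟩
      sum (λ i → sum (λ j → ι (c i ℚ.* q i j) * w j))
        ≈⟨ ∑-comm (λ i j → ι (c i ℚ.* q i j) * w j) ⟩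
      sum (λ j → sum (λ i → ι (c i ℚ.* q i j) * w j))
        ≈⟨ sum-cong-≋ (λ j → trans (sym (*-distribʳ-sum (w j) (λ i → ι (c i ℚ.* q i j))))
             (trans (*-congʳ (trans (sym (ι-sum (λ i → c i ℚ.* q i j)))
               (trans (reflexive (≡.cong ι (proj₂ (proj₂ dep) j))) ι-0))) (zeroˡ (w j)))) ⟩
      sum {N} (λ _ → 0#)
        ≈⟨ sum-replicate-zero N ⟩
      0# ∎)
      where
      q : ∀ i → Vector ℚ N
      q i = proj₁ (b∈V i)
      dep = linearly-dependent N<d (λ ()) q
      c = proj₁ dep

  span-generator : ∀ {N} (w : Vector Carrier N) i → InSpan w (w i)
  span-generator {suc N} w zero = (1ℚ ∷ᵛ λ _ → 0ℚ) , sym (begin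
    ι 1ℚ * w zero + sum (λ i → ι 0ℚ * w (suc i))
      ≈⟨ +-cong (trans (*-congʳ ι-1) (*-identityˡ _))
           (trans (sum-cong-≋ (λ i → trans (*-congʳ ι-0) (zeroˡ (w (suc i))))) (sum-replicate-zero N)) ⟩
    w zero + 0#
      ≈⟨ +-identityʳ _ ⟩
    w zero ∎)
  span-generator {suc N} w (suc i) =
    let q , eq = span-generator (w ∘ suc) i
    in (0ℚ ∷ᵛ q) , trans eq (sym (trans
         (+-congʳ (trans (*-congʳ ι-0) (zeroˡ (w zero)))) (+-identityˡ _)))

  -- The stabiliser of the span V of `w`, that is z V ⊆ V, tested on generators.
  Multiplier : ∀ {d} → Vector Carrier d → Carrier → Set
  Multiplier w z = ∀ i → InSpan w (z * w i)

  multiplier-isSubring : ∀ {d} (w : Vector Carrier d) → IsSubring (Multiplier w)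
  multiplier-isSubring w = record
    { K-resp = λ x≈y x∈W i → span-resp (*-congʳ x≈y) (x∈W i)
    ; K-ι    = λ q i → span-scale q (span-generator w i)
    ; K-+    = λ x∈W y∈W i → span-resp (sym (distribʳ _ _ _)) (span-+ (x∈W i) (y∈W i))
    ; K-neg  = λ {x} x∈W i → span-resp
        (trans (*-congʳ (ι-neg 1ℚ)) (trans (*-congʳ (-‿cong ι-1))
          (trans (sym (-‿distribˡ-* _ _)) (trans (-‿cong (*-identityˡ _)) (-‿distribˡ-* x (w i))))))
        (span-scale (ℚ.- 1ℚ) (x∈W i))
    -- `y * w i` is a rational combination of the `w j`, and `x` sends each of these back into the
    -- span.
    ; K-*    = λ {x} {y} x∈W y∈W i →
        let q , yw≈ = y∈W i
        in span-resp
          (trans (sum-cong-≋ (λ j → solve 3 (λ q x w → q :* (x :* w) := x :* (q :* w)) refl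
                   (ι (q j)) x (w j)))
            (trans (sym (*-distribˡ-sum x (λ j → ι (q j) * w j)))
              (trans (*-congˡ (sym yw≈)) (sym (*-assoc x y (w i))))))
          (span-sum q x∈W)
    }

  ∩-isSubring : ∀ {K L : Carrier → Set} → IsSubring K → IsSubring L →
                IsSubring (λ x → K x × L x)
  ∩-isSubring K-subring L-subring = record
    { K-resp = λ x≈y (x∈K , x∈L) → 𝒦.K-resp x≈y x∈K , ℒ.K-resp x≈y x∈L
    ; K-ι    = λ q → 𝒦.K-ι q , ℒ.K-ι q
    ; K-+    = λ (x∈K , x∈L) (y∈K , y∈L) → 𝒦.K-+ x∈K y∈K , ℒ.K-+ x∈L y∈L
    ; K-neg  = λ (x∈K , x∈L) → 𝒦.K-neg x∈K , ℒ.K-neg x∈L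
    ; K-*    = λ (x∈K , x∈L) (y∈K , y∈L) → 𝒦.K-* x∈K y∈K , ℒ.K-* x∈L y∈L
    }
    where
    module 𝒦 = IsSubring K-subring
    module ℒ = IsSubring L-subring

  module _ {K : Carrier → Set} (subring : IsSubring K) where
    open IsSubring subring

    -- A relation c₀ + c₁ z + ⋯ = 0 is divided by the highest possible power
    -- of z, after which c₀ ≠ 0 and 1 / z = - (c₁ + c₂ z + ⋯) / c₀.
    inverse-from-relation : ∀ {z z⁻¹} → K z → z * z⁻¹ ≈ 1# →
      ∀ {d} (c : Vector ℚ d) → (∃[ i ] c i ≢ 0ℚ) →
      linearCombination c (λ j → z ^ toℕ j) ≈ 0# → K z⁻¹
    inverse-from-relation {z} {z⁻¹} z∈K zz⁻¹≈1 {suc d} c (i , cᵢ≢0) relation =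
      from (c zero ℚP.≟ 0ℚ)
      where
      T : Carrier
      T = linearCombination (c ∘ suc) (λ j → z ^ toℕ j)
      relation′ : ι (c zero) + z * T ≈ 0#
      relation′ = begin
        ι (c zero) + z * T
          ≈⟨ +-cong (sym (*-identityʳ _)) (trans
               (*-distribˡ-sum z (λ j → ι (c (suc j)) * z ^ toℕ j))
               (sum-cong-≋ (λ j → solve 3 (λ z c y → z :* (c :* y) := c :* (z :* y)) refl
                 z (ι (c (suc j))) (z ^ toℕ j)))) ⟩
        linearCombination c (λ j → z ^ toℕ j)
          ≈⟨ relation ⟩
        0# ∎
      quotient : T ≈ - (ι (c zero) * z⁻¹)
      quotient = begin
        T
          ≈⟨ trans (sym (*-identityˡ T)) (*-congʳ (sym zz⁻¹≈1)) ⟩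
        z * z⁻¹ * T
          ≈⟨ solve 4 (λ z z⁻¹ c T → z :* z⁻¹ :* T := z⁻¹ :* (c :+ z :* T) :- c :* z⁻¹) refl
               z z⁻¹ (ι (c zero)) T ⟩
        z⁻¹ * (ι (c zero) + z * T) - ι (c zero) * z⁻¹
          ≈⟨ +-congʳ (trans (*-congˡ relation′) (zeroʳ z⁻¹)) ⟩
        0# - ι (c zero) * z⁻¹
          ≈⟨ +-identityˡ _ ⟩
        - (ι (c zero) * z⁻¹) ∎
      nontrivial : c zero ≡ 0ℚ → ∀ i → c i ≢ 0ℚ → ∃[ i ] c (suc i) ≢ 0ℚ
      nontrivial c₀≡0 zero    c₀≢0 = contradiction c₀≡0 c₀≢0
      nontrivial c₀≡0 (suc i) cᵢ≢0 = i , cᵢ≢0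
      from : Dec (c zero ≡ 0ℚ) → K z⁻¹
      from (yes c₀≡0) = inverse-from-relation z∈K zz⁻¹≈1 (c ∘ suc)
        (nontrivial c₀≡0 i cᵢ≢0)
        (begin
          T                    ≈⟨ quotient ⟩
          - (ι (c zero) * z⁻¹) ≈⟨ -‿cong (*-congʳ (trans (reflexive (≡.cong ι c₀≡0)) ι-0)) ⟩
          - (0# * z⁻¹)         ≈⟨ trans (-‿cong (zeroˡ z⁻¹)) -0#≈0# ⟩
          0#                   ∎)
      from (no c₀≢0) = K-resp
        (begin
          - (ι c₀⁻¹ * T)
            ≈⟨ -‿cong (*-congˡ quotient) ⟩
          - (ι c₀⁻¹ * - (ι (c zero) * z⁻¹))
            ≈⟨ solve 3 (λ a b c → :- (a :* (:- (b :* c))) := a :* b :* c) refl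
                 (ι c₀⁻¹) (ι (c zero)) z⁻¹ ⟩
          ι c₀⁻¹ * ι (c zero) * z⁻¹
            ≈⟨ *-congʳ (trans (sym (ι-* c₀⁻¹ (c zero)))
                 (trans (reflexive (≡.cong ι (ℚP.*-inverseˡ (c zero)))) ι-1)) ⟩
          1# * z⁻¹
            ≈⟨ *-identityˡ z⁻¹ ⟩
          z⁻¹ ∎)
        (K-neg (K-* (K-ι c₀⁻¹) (K-sum (λ j → K-* (K-ι (c (suc j))) (K-^ z∈K (toℕ j))))))
        where
        instance
          c₀-nonZero : ℚ.NonZero (c zero)
          c₀-nonZero = ℚ.≢-nonZero c₀≢0
        c₀⁻¹ : ℚ
        c₀⁻¹ = ℚ.1/ c zero

    -- The powers of a multiplier z lie in the span of w, hence are
    -- linearly dependent.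
    inverse-of-multiplier : ∀ {N} {w : Vector Carrier N} {i₀} → w i₀ ≈ 1# →
      ∀ {z z⁻¹} → Multiplier w z → K z → z * z⁻¹ ≈ 1# → K z⁻¹
    inverse-of-multiplier {N} {w} {i₀} w₀≈1 {z} z∈W z∈K zz⁻¹≈1 =
      inverse-from-relation z∈K zz⁻¹≈1 c c≢0 relation
      where
      dependence = spanned-dependent (ℕP.n<1+n N) (λ j → z ^ toℕ j) λ j →
        span-resp (trans (*-congˡ w₀≈1) (*-identityʳ _))
          (IsSubring.K-^ (multiplier-isSubring w) z∈W (toℕ j) i₀)
      c = proj₁ dependence
      c≢0 = proj₁ (proj₂ dependence)
      relation = proj₂ (proj₂ dependence)

  -- Polynomial values at ρ

  module _ (ρ : Carrier) where

    evaluate : List ℚ → Carrier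
    evaluate []      = 0#
    evaluate (c ∷ P) = ι c + ρ * evaluate P

    ℚ[ρ] : Carrier → Set
    ℚ[ρ] z = ∃[ P ] z ≈ evaluate P

    private
      addᴾ : List ℚ → List ℚ → List ℚ
      addᴾ []      Q       = Q
      addᴾ (c ∷ P) []      = c ∷ P
      addᴾ (c ∷ P) (e ∷ Q) = (c ℚ.+ e) ∷ addᴾ P Q

      scaleᴾ : ℚ → List ℚ → List ℚ
      scaleᴾ e = List.map (e ℚ.*_)

      multiplyᴾ : List ℚ → List ℚ → List ℚ
      multiplyᴾ []      Q = []
      multiplyᴾ (c ∷ P) Q = addᴾ (scaleᴾ c Q) (0ℚ ∷ multiplyᴾ P Q)

      evaluate-add : ∀ P Q → evaluate (addᴾ P Q) ≈ evaluate P + evaluate Q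
      evaluate-add []      Q       = sym (+-identityˡ _)
      evaluate-add (c ∷ P) []      = sym (+-identityʳ _)
      evaluate-add (c ∷ P) (e ∷ Q) = trans
        (+-cong (ι-+ c e) (*-congˡ (evaluate-add P Q)))
        (solve 5 (λ c e ρ p q → (c :+ e) :+ ρ :* (p :+ q) := (c :+ ρ :* p) :+ (e :+ ρ :* q)) refl
          (ι c) (ι e) ρ (evaluate P) (evaluate Q))

      evaluate-scale : ∀ e P → evaluate (scaleᴾ e P) ≈ ι e * evaluate P
      evaluate-scale e []      = sym (zeroʳ (ι e))
      evaluate-scale e (c ∷ P) = trans
        (+-cong (ι-* e c) (*-congˡ (evaluate-scale e P)))
        (solve 4 (λ e c ρ p → e :* c :+ ρ :* (e :* p) := e :* (c :+ ρ :* p)) refl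
          (ι e) (ι c) ρ (evaluate P))

      evaluate-multiply : ∀ P Q → evaluate (multiplyᴾ P Q) ≈ evaluate P * evaluate Q
      evaluate-multiply []      Q = sym (zeroˡ _)
      evaluate-multiply (c ∷ P) Q = begin
        evaluate (addᴾ (scaleᴾ c Q) (0ℚ ∷ multiplyᴾ P Q))
          ≈⟨ evaluate-add (scaleᴾ c Q) (0ℚ ∷ multiplyᴾ P Q) ⟩
        evaluate (scaleᴾ c Q) + (ι 0ℚ + ρ * evaluate (multiplyᴾ P Q))
          ≈⟨ +-cong (evaluate-scale c Q)
               (trans (+-congʳ ι-0) (trans (+-identityˡ _) (*-congˡ (evaluate-multiply P Q)))) ⟩
        ι c * evaluate Q + ρ * (evaluate P * evaluate Q)
          ≈⟨ solve 4 (λ c ρ p q → c :* q :+ ρ :* (p :* q) := (c :+ ρ :* p) :* q) refl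
               (ι c) ρ (evaluate P) (evaluate Q) ⟩
        (ι c + ρ * evaluate P) * evaluate Q ∎

      evaluate-constant : ∀ q → ι q ≈ evaluate (q ∷ [])
      evaluate-constant q = sym (trans (+-congˡ (zeroʳ ρ)) (+-identityʳ (ι q)))

    ℚ[ρ]-isSubring : IsSubring ℚ[ρ]
    ℚ[ρ]-isSubring = record
      { K-resp = λ x≈y (P , x≈P) → P , trans (sym x≈y) x≈P
      ; K-ι    = λ q → q ∷ [] , evaluate-constant q
      ; K-+    = λ (P , x≈) (Q , y≈) → addᴾ P Q , trans (+-cong x≈ y≈) (sym (evaluate-add P Q))
      ; K-neg  = λ (P , x≈) → scaleᴾ (ℚ.- 1ℚ) P , trans (-‿cong x≈) (sym (trans
          (evaluate-scale (ℚ.- 1ℚ) P) (trans (*-congʳ (trans (ι-neg 1ℚ) (-‿cong ι-1)))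
          (trans (sym (-‿distribˡ-* _ _)) (-‿cong (*-identityˡ _))))))
      ; K-*    = λ (P , x≈) (Q , y≈) → multiplyᴾ P Q , trans (*-cong x≈ y≈) (sym (evaluate-multiply P Q))
      }

    ℚ[ρ]-generator : ℚ[ρ] ρ
    ℚ[ρ]-generator = 0ℚ ∷ 1ℚ ∷ [] , (begin
      ρ                            ≈⟨ trans (sym (*-identityʳ ρ)) (*-congˡ (sym ι-1)) ⟩
      ρ * ι 1ℚ                     ≈⟨ *-congˡ (evaluate-constant 1ℚ) ⟩
      ρ * evaluate (1ℚ ∷ [])       ≈⟨ trans (sym (+-identityˡ _)) (+-congʳ (sym ι-0)) ⟩
      evaluate (0ℚ ∷ 1ℚ ∷ [])      ∎)

-- Nonnegative integer matrices

IsNat IsPos : ℤ → Set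
IsNat z = ∃[ a ] z ≡ + a
IsPos z = ∃[ a ] z ≡ + suc a

nat-* : ∀ {y z} → IsNat y → IsNat z → IsNat (y ℤ.* z)
nat-* (a , ≡.refl) (b , ≡.refl) = a ℕ.* b , ≡.sym (ℤP.pos-* a b)

nat-sum : ∀ {d} {t : Vector ℤ d} → (∀ i → IsNat (t i)) → IsNat (sumℤ t)
nat-sum {zero}  t-nat = 0 , ≡.refl
nat-sum {suc d} t-nat =
  let a , t₀≡ = t-nat zero
      b , s≡  = nat-sum (t-nat ∘ suc)
  in a ℕ.+ b , ≡.cong₂ ℤ._+_ t₀≡ s≡

pos-sum : ∀ {d} {t : Vector ℤ d} → (∀ i → IsNat (t i)) → ∀ i → IsPos (t i) → IsPos (sumℤ t)
pos-sum {suc d} t-nat zero (a , t₀≡) =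
  let b , s≡ = nat-sum (t-nat ∘ suc)
  in a ℕ.+ b , ≡.cong₂ ℤ._+_ t₀≡ s≡
pos-sum {suc d} t-nat (suc i) tᵢ-pos =
  let a , t₀≡ = t-nat zero
      b , s≡  = pos-sum (t-nat ∘ suc) i tᵢ-pos
  in a ℕ.+ b , ≡.trans (≡.cong₂ ℤ._+_ t₀≡ s≡) (≡.cong +_ (ℕP.+-suc a b))

NatMatrix : ∀ {d} → Matrix ℤ d → Set
NatMatrix M = ∀ i j → IsNat (M i j)

nat-⊗ : ∀ {d} {M N : Matrix ℤ d} → NatMatrix M → NatMatrix N → NatMatrix (M ⊗ N)
nat-⊗ M-nat N-nat i j = nat-sum (λ l → nat-* (M-nat i l) (N-nat l j))

pos-⊗ : ∀ {d} {M N : Matrix ℤ d} → NatMatrix M → NatMatrix N →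
        ∀ {i} l {j} → IsPos (M i l) → IsPos (N l j) → IsPos ((M ⊗ N) i j)
pos-⊗ M-nat N-nat {i} l {j} (a , M≡) (b , N≡) =
  pos-sum (λ l → nat-* (M-nat i l) (N-nat l j)) l
    -- The predecessor of `suc a * suc b`, as it computes.
    (b ℕ.+ a ℕ.* suc b , ≡.trans (≡.cong₂ ℤ._*_ M≡ N≡) (≡.sym (ℤP.pos-* (suc a) (suc b))))

nat-identity : ∀ {d} → NatMatrix (identity {d})
nat-identity i j with does (i FinP.≟ j)
... | true  = 1 , ≡.refl
... | false = 0 , ≡.refl

nat-β : ∀ {r} k → NatMatrix (β {r} k)
nat-β {r} k zero j with does (toℕ j ℕP.≟ r) | does (toℕ j ℕP.≟ suc r)
... | true  | _     = k , ≡.refl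
... | false | true  = 1 , ≡.refl
... | false | false = 0 , ≡.refl
nat-β k (suc i) j with does (toℕ j ℕP.≟ toℕ i)
... | true  = 1 , ≡.refl
... | false = 0 , ≡.refl

nat-periodMatrix : ∀ {r} k m p → NatMatrix (periodMatrix {r} k m p)
nat-periodMatrix k m zero    = nat-identity
nat-periodMatrix k m (suc p) = nat-⊗ (nat-periodMatrix k m p) (nat-β (k (m ℕ.+ suc p)))

power : ∀ {d} → Matrix ℤ d → ℕ → Matrix ℤ d
power M zero    = identity
power M (suc q) = power M q ⊗ M

nat-power : ∀ {d} {M : Matrix ℤ d} → NatMatrix M → ∀ q → NatMatrix (power M q)
nat-power M-nat zero    = nat-identity
nat-power M-nat (suc q) = nat-⊗ (nat-power M-nat q) M-nat

-- The directed graph of β(k), k ≥ 1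

data Edge {r} : Fin (suc (suc r)) → Fin (suc (suc r)) → Set where
  down        : ∀ i → Edge (suc i) (inject₁ i)
  penultimate : Edge zero (inject₁ (fromℕ r))
  ultimate    : Edge zero (fromℕ (suc r))

data Path {r} (i : Fin (suc (suc r))) : ℕ → Fin (suc (suc r)) → Set where
  []  : Path i 0 i
  _▷_ : ∀ {N l j} → Path i N l → Edge l j → Path i (suc N) j

path-split : ∀ {r} {i j : Fin (suc (suc r))} a {b} → Path i (a ℕ.+ b) j →
             ∃[ l ] Path i b l × Path l a j
path-split zero    path       = _ , path , []
path-split (suc a) (path ▷ e) =
  let l , first , second = path-split a path in l , first , second ▷ e

pos-β : ∀ {r k} {i j : Fin (suc (suc r))} → Edge i j → IsPos (β (suc k) i j)
pos-β (down i)
  rewrite dec-true (toℕ (inject₁ i) ℕP.≟ toℕ i) (FinP.toℕ-inject₁ i) = 0 , ≡.refl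
pos-β {r} {k} penultimate
  rewrite dec-true (toℕ (inject₁ (fromℕ r)) ℕP.≟ r)
            (≡.trans (FinP.toℕ-inject₁ (fromℕ r)) (FinP.toℕ-fromℕ r)) = k , ≡.refl
pos-β {r} {k} ultimate
  -- Row 0 tests column r before column r + 1, so the first test must be refuted before the second
  -- is reached.
  rewrite dec-false (suc (toℕ (fromℕ r)) ℕP.≟ r)
            (ℕP.1+n≢n ∘ ≡.trans (≡.cong suc (≡.sym (FinP.toℕ-fromℕ r))))
        | dec-true (suc (toℕ (fromℕ r)) ℕP.≟ suc r) (≡.cong suc (FinP.toℕ-fromℕ r)) = 0 , ≡.refl

pos-identity : ∀ {d} (i : Fin d) → IsPos (identity i i)
pos-identity i rewrite dec-true (i FinP.≟ i) ≡.refl = 0 , ≡.refl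

-- All `β k` with positive `k` share one graph, so a path of length `p` selects a positive entry
-- from every factor, whatever the digits are; the remaining terms of each product are nonnegative
-- and cannot cancel it.
pos-periodMatrix : ∀ {r} {k : ℕ → ℕ} → (∀ j → ∃[ a ] k (suc j) ≡ suc a) →
  ∀ m p {i j : Fin (suc (suc r))} → Path i p j → IsPos (periodMatrix k m p i j)
pos-periodMatrix k>0 m zero {i} [] = pos-identity i
pos-periodMatrix {k = k} k>0 m (suc p) (_▷_ {l = l} {j} path edge) =
  pos-⊗ (nat-periodMatrix k m p) (nat-β (k (m ℕ.+ suc p))) l
    (pos-periodMatrix k>0 m p path)
    (≡.subst (λ a → IsPos (β a l j)) (≡.sym (proj₂ kₗ>0)) (pos-β edge))
  where
  kₗ>0 : ∃[ a ] k (m ℕ.+ suc p) ≡ suc a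
  kₗ>0 = ≡.subst (λ n → ∃[ a ] k n ≡ suc a) (≡.sym (ℕP.+-suc m p)) (k>0 (m ℕ.+ p))

-- The path is cut into `q` blocks of length `p`, one for each factor `M`.
pos-power : ∀ {r} {M : Matrix ℤ (suc (suc r))} {p} → NatMatrix M →
  (∀ {i j} → Path i p j → IsPos (M i j)) →
  ∀ q {i j} → Path i (q ℕ.* p) j → IsPos (power M q i j)
pos-power M-nat M-pos zero {i} [] = pos-identity i
pos-power {M = M} {p} M-nat M-pos (suc q) path =
  let l , first , second = path-split p path
  in pos-⊗ (nat-power M-nat q) M-nat l (pos-power M-nat M-pos q first) (M-pos second)

-- Walks of prescribed length to vertex 0

path-descend : ∀ {r} {i j : Fin (suc (suc r))} {N} → Path i N j → Path i (toℕ j ℕ.+ N) zero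
path-descend {r} {i} {j} path = go (toℕ j) j ≡.refl path
  where
  -- `inject₁ j` is not structurally smaller than `suc j`, so the recursion runs on the number `n`
  -- instead.
  go : ∀ n (j : Fin (suc (suc r))) {N} → toℕ j ≡ n → Path i N j → Path i (n ℕ.+ N) zero
  go zero    zero    ≡.refl path = path
  go (suc n) (suc j) {N} eq path =
    ≡.subst (λ L → Path i L zero) (ℕP.+-suc n N)
      (go n (inject₁ j) (≡.trans (FinP.toℕ-inject₁ j) (ℕP.suc-injective eq)) (path ▷ down j))

-- With n = r + 1, `penultimate` followed by the descent from n - 1 is a cycle of length n, and
-- `ultimate` followed by the descent from n is one of length n + 1.
path-loops : ∀ {r} {i : Fin (suc (suc r))} {N} a b → Path i N zero →
             Path i (b ℕ.* suc (suc r) ℕ.+ (a ℕ.* suc r ℕ.+ N)) zero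
path-loops zero zero path = path
path-loops {r} {i} {N} (suc a) zero path =
  ≡.subst (λ L → Path i L zero) (eq r (a ℕ.* suc r) N)
    (path-descend (path-loops a zero path ▷ penultimate))
  where
  eq : ∀ r x N → toℕ (inject₁ (fromℕ r)) ℕ.+ suc (x ℕ.+ N) ≡ suc (r ℕ.+ x) ℕ.+ N
  eq r x N rewrite FinP.toℕ-inject₁ (fromℕ r) | FinP.toℕ-fromℕ r =
    solve 3 (λ r x N → r :+ (con 1 :+ (x :+ N)) := con 1 :+ (r :+ x) :+ N) ≡.refl r x N
    where open ℕSolver.+-*-Solver
path-loops {r} {i} {N} a (suc b) path =
  ≡.subst (λ L → Path i L zero) (eq r (b ℕ.* suc (suc r)) (a ℕ.* suc r ℕ.+ N))
    (path-descend (path-loops a b path ▷ ultimate))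
  where
  eq : ∀ r x N → toℕ (fromℕ (suc r)) ℕ.+ suc (x ℕ.+ N) ≡ suc (suc r) ℕ.+ x ℕ.+ N
  eq r x N rewrite FinP.toℕ-fromℕ r =
    solve 3 (λ r x N → con 1 :+ r :+ (con 1 :+ (x :+ N)) := con 2 :+ r :+ x :+ N) ≡.refl r x N
    where open ℕSolver.+-*-Solver

-- With n = r + 1, descend i steps to 0 and follow p′ (n + 1) + i cycles of
-- length n and n - i cycles of length n + 1.
path-to-zero : ∀ {r} p′ (i : Fin (suc (suc r))) →
               Path i (suc r ℕ.* suc (suc r) ℕ.* suc p′) zero
path-to-zero {r} p′ i =
  ≡.subst (λ L → Path i L zero)
    (length p′ (toℕ i) b (suc (suc r)) (suc r) ≡.refl (ℕP.m+[n∸m]≡n i≤n))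
    (path-loops (p′ ℕ.* suc (suc r) ℕ.+ toℕ i) b (path-descend []))
  where
  b : ℕ
  b = suc r ℕ.∸ toℕ i
  i≤n : toℕ i ℕ.≤ suc r
  i≤n = ℕ.s≤s⁻¹ (FinP.toℕ<n i)
  -- The length must be the same for all starts and divisible by the period p′ + 1. The start drops
  -- out of i + i n + (n - i)(n + 1) = n (n + 1), and the p′ (n + 1) further cycles of length n
  -- supply the factor p′ + 1.
  length : ∀ p′ i b s n → s ≡ suc n → i ℕ.+ b ≡ n →
    b ℕ.* s ℕ.+ ((p′ ℕ.* s ℕ.+ i) ℕ.* n ℕ.+ (i ℕ.+ 0)) ≡ n ℕ.* s ℕ.* suc p′
  length p′ i b _ _ ≡.refl ≡.refl =
    solve 3 (λ p i b →
      b :* (con 1 :+ (i :+ b)) :+ ((p :* (con 1 :+ (i :+ b)) :+ i) :* (i :+ b) :+ (i :+ con 0))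
      := (i :+ b) :* (con 1 :+ (i :+ b)) :* (con 1 :+ p)) ≡.refl p′ i b
    where open ℕSolver.+-*-Solver

-- Action of integer matrices

toℚ : ℤ → ℚ
toℚ z = z ℚ./ 1

private
  toℚᵘ-toℚ : ∀ z → ℚ.toℚᵘ (toℚ z) ℚᵘ.≃ ℚᵘ.mkℚᵘ z 0
  toℚᵘ-toℚ z = ℚP.toℚᵘ-fromℚᵘ (ℚᵘ.mkℚᵘ z 0)

-- Normalisation by gcds keeps sums in ℚ from computing on open terms; among unnormalised fractions
-- with denominator 1 the identity is integer arithmetic.
toℚ-+ : ∀ y z → toℚ (y ℤ.+ z) ≡ toℚ y ℚ.+ toℚ z
toℚ-+ y z = ℚP.toℚᵘ-injective (begin
  ℚ.toℚᵘ (toℚ (y ℤ.+ z))                ≈⟨ toℚᵘ-toℚ (y ℤ.+ z) ⟩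
  ℚᵘ.mkℚᵘ (y ℤ.+ z) 0                   ≈⟨ ℚᵘ.*≡* (≡.cong (ℤ._* + 1) (≡.sym
                                             (≡.cong₂ ℤ._+_ (ℤP.*-identityʳ y) (ℤP.*-identityʳ z)))) ⟩
  ℚᵘ.mkℚᵘ y 0 ℚᵘ.+ ℚᵘ.mkℚᵘ z 0          ≈⟨ ℚᵘP.+-cong (toℚᵘ-toℚ y) (toℚᵘ-toℚ z) ⟨
  ℚ.toℚᵘ (toℚ y) ℚᵘ.+ ℚ.toℚᵘ (toℚ z)    ≈⟨ ℚP.toℚᵘ-homo-+ (toℚ y) (toℚ z) ⟨
  ℚ.toℚᵘ (toℚ y ℚ.+ toℚ z)              ∎)
  where open ℚᵘP.≃-Reasoning

toℚ-* : ∀ y z → toℚ (y ℤ.* z) ≡ toℚ y ℚ.* toℚ z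
toℚ-* y z = ℚP.toℚᵘ-injective (begin
  ℚ.toℚᵘ (toℚ (y ℤ.* z))                ≈⟨ toℚᵘ-toℚ (y ℤ.* z) ⟩
  ℚᵘ.mkℚᵘ y 0 ℚᵘ.* ℚᵘ.mkℚᵘ z 0          ≈⟨ ℚᵘP.*-cong (toℚᵘ-toℚ y) (toℚᵘ-toℚ z) ⟨
  ℚ.toℚᵘ (toℚ y) ℚᵘ.* ℚ.toℚᵘ (toℚ z)    ≈⟨ ℚP.toℚᵘ-homo-* (toℚ y) (toℚ z) ⟨
  ℚ.toℚᵘ (toℚ y ℚ.* toℚ z)              ∎)
  where open ℚᵘP.≃-Reasoning

module IntegerAction (F : OrderedFieldOverℚ) where
  open OrderedFieldOverℚ F
  open OrderedField F
  open ≈-Reasoning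

  ιℤ : ℤ → Carrier
  ιℤ z = ι (toℚ z)

  ιℤ-+ : ∀ y z → ιℤ (y ℤ.+ z) ≈ ιℤ y + ιℤ z
  ιℤ-+ y z = trans (reflexive (≡.cong ι (toℚ-+ y z))) (ι-+ (toℚ y) (toℚ z))

  ιℤ-* : ∀ y z → ιℤ (y ℤ.* z) ≈ ιℤ y * ιℤ z
  ιℤ-* y z = trans (reflexive (≡.cong ι (toℚ-* y z))) (ι-* (toℚ y) (toℚ z))

  ιℤ-sum : ∀ {d} (t : Vector ℤ d) → ιℤ (sumℤ t) ≈ sum (ιℤ ∘ t)
  ιℤ-sum {zero}  t = ι-0
  ιℤ-sum {suc d} t = trans (ιℤ-+ (t zero) (sumℤ (t ∘ suc))) (+-congˡ (ιℤ-sum (t ∘ suc)))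

  nonneg-ℕ : ∀ a → Nonneg (ιℤ (+ a))
  nonneg-ℕ zero    = nonneg-resp (sym ι-0) nonneg-0
  nonneg-ℕ (suc a) = nonneg-resp (sym (trans (ιℤ-+ (+ 1) (+ a)) (+-congʳ ι-1)))
    (nonneg+nonneg (pos⇒nonneg pos-1) (nonneg-ℕ a))

  nonneg-ιℤ : ∀ {z} → IsNat z → Nonneg (ιℤ z)
  nonneg-ιℤ (a , ≡.refl) = nonneg-ℕ a

  pos-ιℤ : ∀ {z} → IsPos z → Pos (ιℤ z)
  pos-ιℤ (a , ≡.refl) = pos-resp (sym (trans (ιℤ-+ (+ 1) (+ a)) (+-congʳ ι-1)))
    (pos+nonneg pos-1 (nonneg-ℕ a))

  infixr 8 _•_
  _•_ : ∀ {d} → Matrix ℤ d → Vector Carrier d → Vector Carrier d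
  (M • v) i = sum (λ j → ιℤ (M i j) * v j)

  •-cong : ∀ {d} (M : Matrix ℤ d) {v w : Vector Carrier d} →
           (∀ i → v i ≈ w i) → ∀ i → (M • v) i ≈ (M • w) i
  •-cong M v≈w i = sum-cong-≋ (λ j → *-congˡ {ιℤ (M i j)} (v≈w j))

  •-scale : ∀ {d} (M : Matrix ℤ d) c (v : Vector Carrier d) →
            ∀ i → (M • λ j → c * v j) i ≈ c * (M • v) i
  •-scale M c v i = trans
    (sum-cong-≋ (λ j → solve 3 (λ m c v → m :* (c :* v) := c :* (m :* v)) refl (ιℤ (M i j)) c (v j)))
    (sym (*-distribˡ-sum c (λ j → ιℤ (M i j) * v j)))

  •-⊗ : ∀ {d} (M N : Matrix ℤ d) v → ∀ i → ((M ⊗ N) • v) i ≈ (M • N • v) i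
  •-⊗ M N v i = begin
    sum (λ j → ιℤ ((M ⊗ N) i j) * v j)
      ≈⟨ sum-cong-≋ (λ j → trans
           (*-congʳ (trans (ιℤ-sum (λ l → M i l ℤ.* N l j)) (sum-cong-≋ (λ l → ιℤ-* (M i l) (N l j)))))
           (trans (*-distribʳ-sum (v j) (λ l → ιℤ (M i l) * ιℤ (N l j)))
             (sum-cong-≋ (λ l → *-assoc (ιℤ (M i l)) (ιℤ (N l j)) (v j))))) ⟩
    sum (λ j → sum (λ l → ιℤ (M i l) * (ιℤ (N l j) * v j)))
      ≈⟨ ∑-comm (λ j l → ιℤ (M i l) * (ιℤ (N l j) * v j)) ⟩
    sum (λ l → sum (λ j → ιℤ (M i l) * (ιℤ (N l j) * v j)))
      ≈⟨ sum-cong-≋ (λ l → *-distribˡ-sum (ιℤ (M i l)) (λ j → ιℤ (N l j) * v j)) ⟨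
    (M • N • v) i ∎

  sum-single : ∀ {d} (c : Fin d → ℤ) (v : Vector Carrier d) l → c l ≡ + 1 →
               (∀ j → j ≢ l → c j ≡ + 0) → sum (λ j → ιℤ (c j) * v j) ≈ v l
  sum-single {suc d} c v zero c₀≡1 c≡0 = trans
    (+-cong (trans (*-congʳ (trans (reflexive (≡.cong ιℤ c₀≡1)) ι-1)) (*-identityˡ (v zero)))
      (trans (sum-cong-≋ (λ j → trans
        (*-congʳ (trans (reflexive (≡.cong ιℤ (c≡0 (suc j) λ ()))) ι-0)) (zeroˡ (v (suc j)))))
        (sum-replicate-zero d)))
    (+-identityʳ (v zero))
  sum-single {suc d} c v (suc l) cₗ≡1 c≡0 = trans
    (+-cong
      (trans (*-congʳ (trans (reflexive (≡.cong ιℤ (c≡0 zero λ ()))) ι-0)) (zeroˡ (v zero)))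
      (sum-single (c ∘ suc) (v ∘ suc) l cₗ≡1 (λ j j≢l → c≡0 (suc j) (j≢l ∘ FinP.suc-injective))))
    (+-identityˡ (v (suc l)))

  identity-• : ∀ {d} (v : Vector Carrier d) i → (identity • v) i ≈ v i
  identity-• v i = sum-single (identity i) v i
    (≡.cong (if_then + 1 else + 0) (dec-true (i FinP.≟ i) ≡.refl))
    (λ j j≢i → ≡.cong (if_then + 1 else + 0) (dec-false (i FinP.≟ j) (j≢i ∘ ≡.sym)))

  β-•-suc : ∀ {r} k (v : Vector Carrier (suc (suc r))) i → (β k • v) (suc i) ≈ v (inject₁ i)
  β-•-suc k v i = sum-single (β k (suc i)) v (inject₁ i)
    (≡.cong (if_then + 1 else + 0) (dec-true (toℕ (inject₁ i) ℕP.≟ toℕ i) (FinP.toℕ-inject₁ i)))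
    (λ j j≢i → ≡.cong (if_then + 1 else + 0) (dec-false (toℕ j ℕP.≟ toℕ i)
      (λ eq → j≢i (FinP.toℕ-injective (≡.trans eq (≡.sym (FinP.toℕ-inject₁ i)))))))

  β-•-zero : ∀ {r} k (v : Vector Carrier (suc (suc r))) →
    (β k • v) zero ≈ ιℤ (+ k) * v (inject₁ (fromℕ r)) + v (fromℕ (suc r))
  β-•-zero {r} k v = begin
    sum (λ j → ιℤ (β k zero j) * v j)
      ≈⟨ sum-init-last (λ j → ιℤ (β k zero j) * v j) ⟩
    sum (λ j → ιℤ (β k zero (inject₁ j)) * v (inject₁ j)) + ιℤ (β {r} k zero (fromℕ (suc r))) * v (fromℕ (suc r))
      ≈⟨ +-cong (trans
           (sum-cong-≋ (λ j → trans (*-congʳ (entry j)) (*-assoc (ιℤ (+ k)) (ιℤ (δ j)) (v (inject₁ j)))))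
           (trans (sym (*-distribˡ-sum (ιℤ (+ k)) (λ j → ιℤ (δ j) * v (inject₁ j))))
             (*-congˡ (sum-single δ (v ∘ inject₁) (fromℕ r)
               (≡.cong (if_then + 1 else + 0) (dec-true (toℕ (fromℕ r) ℕP.≟ r) (FinP.toℕ-fromℕ r)))
               (λ j j≢r → ≡.cong (if_then + 1 else + 0) (dec-false (toℕ j ℕP.≟ r)
                 (λ eq → j≢r (FinP.toℕ-injective (≡.trans eq (≡.sym (FinP.toℕ-fromℕ r)))))))))))
         (trans (*-congʳ (trans (reflexive (≡.cong ιℤ last-entry)) ι-1)) (*-identityˡ _)) ⟩
    ιℤ (+ k) * v (inject₁ (fromℕ r)) + v (fromℕ (suc r)) ∎
    where
    δ : Fin (suc r) → ℤ
    δ j = if does (toℕ j ℕP.≟ r) then + 1 else + 0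
    last-entry : β {r} k zero (fromℕ (suc r)) ≡ + 1
    last-entry = ≡.trans
      (≡.cong (if_then + k else (if does (toℕ (fromℕ (suc r)) ℕP.≟ suc r) then + 1 else + 0))
        (dec-false (toℕ (fromℕ (suc r)) ℕP.≟ r)
        (ℕP.1+n≢n ∘ ≡.trans (≡.cong suc (≡.sym (FinP.toℕ-fromℕ r))))))
      (≡.cong (if_then + 1 else + 0) (dec-true (toℕ (fromℕ (suc r)) ℕP.≟ suc r) (FinP.toℕ-fromℕ (suc r))))
    -- Off the last column the inner test fails, so row 0 of `β k` is there `k` times an indicator,
    -- and `sum-single` applies to the indicator.
    factor : ∀ {P Q : Set} (P? : Dec P) (Q? : Dec Q) → ¬ Q →
      (if does P? then + k else (if does Q? then + 1 else + 0)) ≡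
      + k ℤ.* (if does P? then + 1 else + 0)
    factor (yes _) _       ¬q = ≡.sym (ℤP.*-identityʳ (+ k))
    factor (no _)  (yes q) ¬q = contradiction q ¬q
    factor (no _)  (no _)  ¬q = ≡.sym (ℤP.*-zeroʳ (+ k))
    entry-ℤ : ∀ j → β {r} k zero (inject₁ j) ≡ + k ℤ.* δ j
    entry-ℤ j rewrite FinP.toℕ-inject₁ j =
      factor (toℕ j ℕP.≟ r) (toℕ j ℕP.≟ suc r) (ℕP.<⇒≢ (FinP.toℕ<n j))
    entry : ∀ j → ιℤ (β {r} k zero (inject₁ j)) ≈ ιℤ (+ k) * ιℤ (δ j)
    entry j = trans (reflexive (≡.cong ιℤ (entry-ℤ j))) (ιℤ-* (+ k) (δ j))

  -- Transport of eigenvectors along an expansion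

  module _ {r} {k : ℕ → ℕ} {h : ℕ → Carrier} {v : ℕ → Vector Carrier (suc (suc r))}
    (h>0 : ∀ j → Pos (h j))
    (step : ∀ j i → h j * (β (k (suc j)) • v (suc j)) i ≈ v j i) where

    -- `H` is the product of the scalars `h m`, ..., `h (m + p - 1)`, which for a Selmer expansion
    -- are the first coordinates met along the period.
    periodMatrix-• : ∀ m p → ∃[ H ] Pos H × (∀ i → H * (periodMatrix k m p • v (m ℕ.+ p)) i ≈ v m i)
    periodMatrix-• m zero = 1# , pos-1 , λ i → trans (*-identityˡ _)
      (trans (identity-• (v (m ℕ.+ 0)) i) (reflexive (≡.cong (λ j → v j i) (ℕP.+-identityʳ m))))
    periodMatrix-• m (suc p) =
      let H , H>0 , eq = periodMatrix-• m p
          P = periodMatrix k m p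
          j = m ℕ.+ p
      in H * h j , *-pos H>0 (h>0 j) ,
        ≡.subst (λ l → ∀ i → H * h j * ((P ⊗ β (k l)) • v l) i ≈ v m i) (≡.sym (ℕP.+-suc m p))
          λ i → begin
            H * h j * ((P ⊗ β (k (suc j))) • v (suc j)) i
              ≈⟨ trans (*-congˡ (•-⊗ P (β (k (suc j))) (v (suc j)) i)) (*-assoc _ _ _) ⟩
            H * (h j * (P • β (k (suc j)) • v (suc j)) i)
              ≈⟨ *-congˡ (•-scale P (h j) (β (k (suc j)) • v (suc j)) i) ⟨
            H * (P • λ l → h j * (β (k (suc j)) • v (suc j)) l) i
              ≈⟨ *-congˡ (•-cong P (step j) i) ⟩
            H * (P • v j) i
              ≈⟨ eq i ⟩
            v m i ∎

    -- The eigenvalue is the reciprocal of the product `H` of the first coordinates over one period.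
    periodic-eigenvalue : ∀ m p → (∀ i → v (m ℕ.+ p) i ≈ v m i) →
      ∃[ σ ] Pos σ × (∀ i → (periodMatrix k m p • v m) i ≈ σ * v m i)
    periodic-eigenvalue m p periodic =
      let H , H>0 , eq = periodMatrix-• m p
          σ , σ>0 , Hσ≈1 = inverse H>0
          P = periodMatrix k m p
      in σ , σ>0 , λ i → begin
        (P • v m) i
          ≈⟨ trans (sym (*-identityˡ _)) (*-congʳ (trans (sym Hσ≈1) (*-comm H σ))) ⟩
        σ * H * (P • v m) i
          ≈⟨ trans (*-assoc _ _ _) (*-congˡ (*-congˡ (sym (•-cong P periodic i)))) ⟩
        σ * (H * (P • v (m ℕ.+ p)) i)
          ≈⟨ *-congˡ (eq i) ⟩
        σ * v m i ∎

    module _ {K : Carrier → Set} (subfield : IsSubfield K)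
      (v₀≈1 : ∀ j → v j zero ≈ 1#) where
      open IsSubfield subfield

      -- The scalar `h j` is not assumed to lie in `K`. Row 0 of the step relation, with
      -- `v j zero ≈ 1#`, exhibits it as the reciprocal of an element of `K`; the other rows then
      -- give the other coordinates.
      K-backwards-step : ∀ j → (∀ i → K (v (suc j) i)) → ∀ i → K (v j i)
      K-backwards-step j v∈K i = K-resp (step j i) (K-* h∈K (βv∈K i))
        where
        βv∈K : ∀ i → K ((β (k (suc j)) • v (suc j)) i)
        βv∈K i = K-sum (λ l → K-* (K-ι (toℚ (β (k (suc j)) i l))) (v∈K l))
        βv₀h≈1 : (β (k (suc j)) • v (suc j)) zero * h j ≈ 1#
        βv₀h≈1 = trans (*-comm _ _) (trans (step j zero) (v₀≈1 j))
        h∈K : K (h j)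
        h∈K = K-inv (pos-cancelʳ (pos-resp (sym βv₀h≈1) pos-1) (h>0 j)) βv₀h≈1 (βv∈K zero)

      K-backwards : ∀ m → (∀ i → K (v m i)) → ∀ i → K (v 0 i)
      K-backwards zero    v∈K = v∈K
      K-backwards (suc m) v∈K = K-backwards m (K-backwards-step m v∈K)

  power-• : ∀ {d} {M : Matrix ℤ d} {w : Vector Carrier d} {ρ} →
    (∀ i → (M • w) i ≈ ρ * w i) → ∀ q i → (power M q • w) i ≈ ρ ^ q * w i
  power-• Mw zero i = trans (identity-• _ i) (sym (*-identityˡ _))
  power-• {M = M} {w} {ρ} Mw (suc q) i = begin
    ((power M q ⊗ M) • w) i
      ≈⟨ •-⊗ (power M q) M w i ⟩
    (power M q • M • w) i
      ≈⟨ •-cong (power M q) Mw i ⟩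
    (power M q • λ j → ρ * w j) i
      ≈⟨ •-scale (power M q) ρ w i ⟩
    ρ * (power M q • w) i
      ≈⟨ *-congˡ (power-• Mw q i) ⟩
    ρ * (ρ ^ q * w i)
      ≈⟨ *-assoc _ _ _ ⟨
    ρ * ρ ^ q * w i ∎

  pos-^ : ∀ {x} → Pos x → ∀ q → Pos (x ^ q)
  pos-^ x>0 zero    = pos-1
  pos-^ x>0 (suc q) = *-pos x>0 (pos-^ x>0 q)

  eigenvector-in-subfield : ∀ {K} → IsSubfield K →
    ∀ {N} {M : Matrix ℤ (suc N)} {w : Vector Carrier (suc N)} {ρ} →
    NatMatrix M → (∀ i → IsPos (M i zero)) → (∀ i → Pos (w i)) → w zero ≈ 1# →
    Pos ρ → K ρ → (∀ i → (M • w) i ≈ ρ * w i) → ∀ i → K (w i)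
  eigenvector-in-subfield {K} subfield {N} {M} {w} {ρ} M-nat M-pos w>0 w₀≈1 ρ>0 ρ∈K Mw = λ where
      zero    → K-resp (sym w₀≈1) K-1
      (suc i) → positive-solution subfield
        {C = λ i j → s * ιℤ (M (suc i) (suc j))} {b = λ i → s * ιℤ (M (suc i) zero)}
        (λ i j → K-* s∈K (K-ι _)) (λ i → K-* s∈K (K-ι _))
        (λ i j → nonneg*nonneg (pos⇒nonneg s>0) (nonneg-ιℤ (M-nat (suc i) (suc j))))
        (λ i → *-pos s>0 (pos-ιℤ (M-pos (suc i)))) (w>0 ∘ suc) eq i
    where
    open IsSubfield subfield
    s : Carrier
    s = proj₁ (inverse ρ>0)
    s>0 : Pos s
    s>0 = proj₁ (proj₂ (inverse ρ>0))
    ρs≈1 : ρ * s ≈ 1#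
    ρs≈1 = proj₂ (proj₂ (inverse ρ>0))
    s∈K : K s
    s∈K = K-inv ρ>0 ρs≈1 ρ∈K
    eq : ∀ i → w (suc i) ≈ s * ιℤ (M (suc i) zero) + sum (λ j → s * ιℤ (M (suc i) (suc j)) * w (suc j))
    eq i = begin
      w (suc i)
        ≈⟨ trans (sym (*-identityˡ _)) (*-congʳ (trans (sym ρs≈1) (*-comm ρ s))) ⟩
      s * ρ * w (suc i)
        ≈⟨ trans (*-assoc _ _ _) (*-congˡ (sym (Mw (suc i)))) ⟩
      s * (ιℤ (M (suc i) zero) * w zero + sum (λ j → ιℤ (M (suc i) (suc j)) * w (suc j)))
        ≈⟨ distribˡ _ _ _ ⟩
      s * (ιℤ (M (suc i) zero) * w zero) + s * sum (λ j → ιℤ (M (suc i) (suc j)) * w (suc j))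
        ≈⟨ +-cong (*-congˡ (trans (*-congˡ w₀≈1) (*-identityʳ _)))
             (trans (*-distribˡ-sum s (λ j → ιℤ (M (suc i) (suc j)) * w (suc j)))
               (sum-cong-≋ (λ j → sym (*-assoc s (ιℤ (M (suc i) (suc j))) (w (suc j)))))) ⟩
      s * ιℤ (M (suc i) zero) + sum (λ j → s * ιℤ (M (suc i) (suc j)) * w (suc j)) ∎

  period-eigenvector-in-subfield : ∀ {K} → IsSubfield K →
    ∀ {r} {k : ℕ → ℕ} → (∀ j → ∃[ a ] k (suc j) ≡ suc a) → ∀ m p′ →
    ∀ {w : Vector Carrier (suc (suc r))} {ρ} → (∀ i → Pos (w i)) → w zero ≈ 1# →
    Pos ρ → K ρ → (∀ i → (periodMatrix k m (suc p′) • w) i ≈ ρ * w i) → ∀ i → K (w i)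
  period-eigenvector-in-subfield subfield {r} {k} k>0 m p′ w>0 w₀≈1 ρ>0 ρ∈K Mw =
    eigenvector-in-subfield subfield {M = power M q} (nat-power M-nat q)
      (λ i → pos-power M-nat (pos-periodMatrix k>0 m (suc p′)) q (path-to-zero p′ i))
      w>0 w₀≈1 (pos-^ ρ>0 q) (IsSubfield.K-^ subfield ρ∈K q) (power-• {M = M} Mw q)
    where
    M : Matrix ℤ (suc (suc r))
    M = periodMatrix k m (suc p′)
    M-nat : NatMatrix M
    M-nat = nat-periodMatrix k m (suc p′)
    -- With n = r + 1 this is n (n + 1), so that `q * suc p′` is the walk length of `path-to-zero`.
    q : ℕ
    q = suc r ℕ.* suc (suc r)

-- Wrapping ≈ℝ and <ℝ in records keeps Agda from unfolding them, so that
-- their arguments can be inferred.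

infix 4 _≃_
record _≃_ (x y : ℝ) : Set where
  constructor mk≃
  field get≃ : x ≈ℝ y
open _≃_

record Positive (x : ℝ) : Set where
  constructor mkPos
  field getPos : 0ℝ <ℝ x
open Positive

-- The Cauchy reals as an ordered field over ℚ

module RealNumbers where
  open import Data.Rational.Base using (_+_; _*_; -_; _-_; ∣_∣)

  pointwise : ∀ {x y} → (∀ n → seq x n ≡ seq y n) → x ≃ y
  pointwise {x} {y} eq = mk≃ λ ε 0<ε → 0 , λ n _ →
    ≡.subst (λ z → ∣ z ∣ ℚ.< ε)
      (≡.sym (≡.trans (≡.cong (_- seq y n) (eq n)) (ℚP.+-inverseʳ (seq y n)))) 0<ε

  ≃-sym : ∀ {x y} → x ≃ y → y ≃ x
  ≃-sym {x} {y} (mk≃ x≈y) = mk≃ λ ε 0<ε →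
    let N , close = x≈y ε 0<ε
    in N , λ n N≤n → ≡.subst (ℚ._< ε)
      (≡.trans (≡.sym (ℚP.∣-p∣≡∣p∣ (seq x n - seq y n)))
        (≡.cong ∣_∣ (flip-diff (seq x n) (seq y n))))
      (close n N≤n)
    where
    flip-diff : ∀ a b → - (a - b) ≡ b - a
    flip-diff = solve 2 (λ a b → :- (a :- b) := b :- a) ≡.refl
      where open ℚSolver.+-*-Solver

  private
    ⊔-left : ∀ {M N n} → M ℕ.⊔ N ℕ.≤ n → M ℕ.≤ n
    ⊔-left {M} {N} = ℕP.m⊔n≤o⇒m≤o M N

    ⊔-right : ∀ {M N n} → M ℕ.⊔ N ℕ.≤ n → N ℕ.≤ n
    ⊔-right {M} {N} = ℕP.m⊔n≤o⇒n≤o M N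

    close-sum : ∀ {a b c s t ε} → c ≡ a + b → ∣ a ∣ ℚ.< s → ∣ b ∣ ℚ.< t → s + t ≡ ε → ∣ c ∣ ℚ.< ε
    close-sum {a} {b} ≡.refl a<s b<t ≡.refl =
      ℚP.≤-<-trans (ℚP.∣p+q∣≤∣p∣+∣q∣ a b) (ℚP.+-mono-< a<s b<t)

    +-cancelˡ : ∀ c {a b} → c + a ℚ.≤ c + b → a ℚ.≤ b
    +-cancelˡ c {a} {b} h = ≡.subst₂ ℚ._≤_ (eq c a) (eq c b) (ℚP.+-monoʳ-≤ (- c) h)
      where
      eq : ∀ c a → - c + (c + a) ≡ a
      eq = solve 2 (λ c a → :- c :+ (c :+ a) := a) ≡.refl
        where open ℚSolver.+-*-Solver

  ≃-trans : ∀ {x y z} → x ≃ y → y ≃ z → x ≃ z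
  ≃-trans {x} {y} {z} (mk≃ x≈y) (mk≃ y≈z) = mk≃ λ ε 0<ε →
    let M , close₁ = x≈y (ε * ½) (pos-½ 0<ε)
        N , close₂ = y≈z (ε * ½) (pos-½ 0<ε)
    in M ℕ.⊔ N , λ n h → close-sum {seq x n - seq y n} {seq y n - seq z n}
         (insert (seq x n) (seq y n) (seq z n))
         (close₁ n (⊔-left {M} h)) (close₂ n (⊔-right {M} h)) (half+half ε)
    where
    insert : ∀ a b c → a - c ≡ (a - b) + (b - c)
    insert = solve 3 (λ a b c → a :- c := (a :- b) :+ (b :- c)) ≡.refl
      where open ℚSolver.+-*-Solver

  +-cong : ∀ {x x′ y y′} → x ≃ x′ → y ≃ y′ → x +ℝ y ≃ x′ +ℝ y′
  +-cong {x} {x′} {y} {y′} (mk≃ x≈) (mk≃ y≈) = mk≃ λ ε 0<ε →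
    let M , close₁ = x≈ (ε * ½) (pos-½ 0<ε)
        N , close₂ = y≈ (ε * ½) (pos-½ 0<ε)
    in M ℕ.⊔ N , λ n h → close-sum {seq x n - seq x′ n} {seq y n - seq y′ n}
         (diff-+ (seq x n) (seq y n) (seq x′ n) (seq y′ n))
         (close₁ n (⊔-left {M} h)) (close₂ n (⊔-right {M} h)) (half+half ε)

  -‿cong : ∀ {x y} → x ≃ y → -ℝ x ≃ -ℝ y
  -‿cong {x} {y} (mk≃ x≈y) = mk≃ λ ε 0<ε →
    let N , close = x≈y ε 0<ε
    in N , λ n N≤n → ≡.subst (ℚ._< ε)
      (≡.trans (≡.sym (ℚP.∣-p∣≡∣p∣ (seq x n - seq y n)))
        (≡.cong ∣_∣ (≡.sym (diff-neg (seq x n) (seq y n)))))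
      (close n N≤n)

  *-cong : ∀ {x x′ y y′} → x ≃ x′ → y ≃ y′ → x *ℝ y ≃ x′ *ℝ y′
  *-cong {x} {x′} {y} {y′} (mk≃ x≈) (mk≃ y≈) = mk≃ λ ε 0<ε →
    let A , 0<A , M₁ , x-bounded = bounded x
        B , 0<B , M₂ , y′-bounded = bounded y′
        N₁ , x-close = x≈ (ε * ½ * inv 0<B) (pos-* (pos-½ 0<ε) (inv-pos 0<B))
        N₂ , y-close = y≈ (ε * ½ * inv 0<A) (pos-* (pos-½ 0<ε) (inv-pos 0<A))
    in (M₁ ℕ.⊔ M₂) ℕ.⊔ (N₁ ℕ.⊔ N₂) , λ n h →
      close-* 0<A 0<B (seq x n) (seq y n) (seq x′ n) (seq y′ n) ε
        (x-bounded n (⊔-left {M₁} (⊔-left {M₁ ℕ.⊔ M₂} h)))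
        (y′-bounded n (⊔-right {M₁} (⊔-left {M₁ ℕ.⊔ M₂} h)))
        (y-close n (⊔-right {N₁} (⊔-right {M₁ ℕ.⊔ M₂} h)))
        (x-close n (⊔-left {N₁} (⊔-right {M₁ ℕ.⊔ M₂} h)))

  ℝ-commutativeRing : CommutativeRing 0ℓ 0ℓ
  ℝ-commutativeRing = record
    { Carrier = ℝ ; _≈_ = _≃_ ; _+_ = _+ℝ_ ; _*_ = _*ℝ_ ; -_ = -ℝ_ ; 0# = 0ℝ ; 1# = 1ℝ
    ; isCommutativeRing = record
      { isRing = record
        { +-isAbelianGroup = record
          { isGroup = record
            { isMonoid = record
              { isSemigroup = record
                { isMagma = record
                  { isEquivalence = record
                    { refl = pointwise λ _ → ≡.refl ; sym = ≃-sym ; trans = ≃-trans }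
                  ; ∙-cong = +-cong }
                ; assoc = λ x y z → pointwise λ n → ℚP.+-assoc (seq x n) (seq y n) (seq z n) }
              ; identity = (λ x → pointwise λ n → ℚP.+-identityˡ (seq x n))
                         , (λ x → pointwise λ n → ℚP.+-identityʳ (seq x n)) }
            ; inverse = (λ x → pointwise λ n → ℚP.+-inverseˡ (seq x n))
                      , (λ x → pointwise λ n → ℚP.+-inverseʳ (seq x n))
            ; ⁻¹-cong = -‿cong }
          ; comm = λ x y → pointwise λ n → ℚP.+-comm (seq x n) (seq y n) }
        ; *-cong = *-cong
        ; *-assoc = λ x y z → pointwise λ n → ℚP.*-assoc (seq x n) (seq y n) (seq z n)
        ; *-identity = (λ x → pointwise λ n → ℚP.*-identityˡ (seq x n))
                     , (λ x → pointwise λ n → ℚP.*-identityʳ (seq x n))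
        ; distrib = (λ x y z → pointwise λ n → ℚP.*-distribˡ-+ (seq x n) (seq y n) (seq z n))
                  , (λ x y z → pointwise λ n → ℚP.*-distribʳ-+ (seq x n) (seq y n) (seq z n)) }
      ; *-comm = λ x y → pointwise λ n → ℚP.*-comm (seq x n) (seq y n) } }

  -- The modulus of continuity N makes one term above q + q decide positivity.
  eventually-above : ∀ x {q} → 0ℚ ℚ.< q →
    ∃[ N ] (∀ M → N ℕ.≤ M → q + q ℚ.≤ seq x M → Positive x)
  eventually-above x {q} 0<q =
    let N , close = cauchy x q 0<q
    in N , λ M N≤M 2q≤x → mkPos (q , 0<q , N , λ n N≤n →
         ≡.subst (ℚ._≤ seq x n) (≡.sym (ℚP.+-identityˡ q))
           (+-cancelˡ q (ℚP.≤-trans 2q≤x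
             (ℚP.<⇒≤ (near (seq x M) (seq x n) q (close M n N≤M N≤n))))))

  private
    quarter : ∀ ε → (ε * ½ * ½ + ε * ½ * ½) + (ε * ½ * ½ + ε * ½ * ½) ≡ ε
    quarter ε = ≡.trans (≡.cong₂ _+_ (half+half (ε * ½)) (half+half (ε * ½))) (half+half ε)

  -- Let q = ε / 4 and compare the single rational `seq x M` with 2 q. If it is at least 2 q, then
  -- `x` is positive; otherwise `x` stays below 3 q from `M` on, which leaves at least q of x + y ≥
  -- 4 q to `y`.
  positive-cotrans : ∀ x y → Positive (x +ℝ y) → Positive x ⊎ Positive y
  positive-cotrans x y (mkPos (ε , 0<ε , N , ε≤x+y)) =
    decide (ℚP.≤-total (q + q) (seq x M))
    where
    q : ℚ
    q = ε * ½ * ½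
    0<q : 0ℚ ℚ.< q
    0<q = pos-½ (pos-½ 0<ε)
    N₁ : ℕ
    N₁ = proj₁ (eventually-above x 0<q)
    N₂ : ℕ
    N₂ = proj₁ (cauchy x q 0<q)
    M : ℕ
    M = N₁ ℕ.⊔ N₂
    decide : q + q ℚ.≤ seq x M ⊎ seq x M ℚ.≤ q + q → Positive x ⊎ Positive y
    decide (inj₁ 2q≤x) = inj₁ (proj₂ (eventually-above x 0<q) M (ℕP.m≤m⊔n N₁ N₂) 2q≤x)
    decide (inj₂ x≤2q) = inj₂ (mkPos (q , 0<q , N ℕ.⊔ M , λ n h →
      ≡.subst (ℚ._≤ seq y n) (≡.sym (ℚP.+-identityˡ q))
        (+-cancelˡ (q + (q + q)) (begin
          q + (q + q) + q           ≡⟨ four q ⟩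
          (q + q) + (q + q)         ≡⟨ quarter ε ⟩
          ε                         ≡⟨ ℚP.+-identityˡ ε ⟨
          0ℚ + ε                    ≤⟨ ε≤x+y n (⊔-left {N} h) ⟩
          seq x n + seq y n         ≤⟨ ℚP.+-monoˡ-≤ (seq y n) (ℚP.<⇒≤ (near (seq x n) (seq x M) q
                                         (proj₂ (cauchy x q 0<q) n M
                                           (⊔-right {N₁} (⊔-right {N} h)) (ℕP.m≤n⊔m N₁ N₂)))) ⟩
          q + seq x M + seq y n     ≤⟨ ℚP.+-monoˡ-≤ (seq y n) (ℚP.+-monoʳ-≤ q x≤2q) ⟩
          q + (q + q) + seq y n     ∎))))
      where
      open ℚP.≤-Reasoning
      four : ∀ q → q + (q + q) + q ≡ (q + q) + (q + q)
      four = solve 1 (λ q → q :+ (q :+ q) :+ q := (q :+ q) :+ (q :+ q)) ≡.refl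
        where open ℚSolver.+-*-Solver

  -- Refuting positivity of `x` and of `-ℝ x` bounds one late term by 2 q in absolute value, with q
  -- = ε / 4; the Cauchy condition carries this to all later terms at a cost below 2 q.
  ¬positive⇒≃0 : ∀ {x} → ¬ Positive x → ¬ Positive (-ℝ x) → x ≃ 0ℝ
  ¬positive⇒≃0 {x} x≯0 x≮0 = mk≃ λ ε 0<ε →
    let q = ε * ½ * ½
        0<q = pos-½ (pos-½ 0<ε)
        N₁ , above = eventually-above x 0<q
        N₂ , below = eventually-above (-ℝ x) 0<q
        N₃ , close = cauchy x q 0<q
        N = N₁ ℕ.⊔ (N₂ ℕ.⊔ N₃)
        N₁≤N = ⊔-left {N₁} {N₂ ℕ.⊔ N₃} (ℕP.≤-refl {N})
        N₂≤N = ⊔-left {N₂} {N₃} (⊔-right {N₁} {N₂ ℕ.⊔ N₃} (ℕP.≤-refl {N}))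
        N₃≤N = ⊔-right {N₂} {N₃} (⊔-right {N₁} {N₂ ℕ.⊔ N₃} (ℕP.≤-refl {N}))
        x<2q = ℚP.≰⇒> (λ h → x≯0 (above N N₁≤N h))
        -x<2q = ℚP.≰⇒> (λ h → x≮0 (below N N₂≤N h))
    in N , λ n N≤n → close-sum {seq x n - seq x N} {seq x N}
         {s = q + q}
         (minus-zero (seq x n) (seq x N))
         (ℚP.<-trans (close n N (⊔-right {N₂} (⊔-right {N₁} N≤n)) N₃≤N)
           (≡.subst (ℚ._< q + q) (ℚP.+-identityˡ q) (ℚP.+-monoˡ-< q 0<q)))
         (abs< (seq x N) x<2q -x<2q) (quarter ε)
    where
    minus-zero : ∀ a b → a - 0ℚ ≡ (a - b) + b
    minus-zero = solve 2 (λ a b → a :- con 0ℚ := (a :- b) :+ b) ≡.refl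
      where open ℚSolver.+-*-Solver
    abs< : ∀ a {b} → a ℚ.< b → - a ℚ.< b → ∣ a ∣ ℚ.< b
    abs< a {b} a<b -a<b with ℚP.∣p∣≡p∨∣p∣≡-p a
    ... | inj₁ eq = ≡.subst (ℚ._< b) (≡.sym eq) a<b
    ... | inj₂ eq = ≡.subst (ℚ._< b) (≡.sym eq) -a<b

  positive-resp : ∀ {x y} → x ≃ y → Positive x → Positive y
  positive-resp {x} {y} (mk≃ x≈y) (mkPos (ε , 0<ε , M , ε≤x)) =
    let N , close = x≈y (ε * ½) (pos-½ 0<ε)
    in mkPos (ε * ½ , pos-½ 0<ε , M ℕ.⊔ N , λ n h →
         ≡.subst (ℚ._≤ seq y n) (≡.sym (ℚP.+-identityˡ (ε * ½)))
           (+-cancelˡ (ε * ½) (≡.subst (ℚ._≤ ε * ½ + seq y n)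
             (≡.trans (ℚP.+-identityˡ ε) (≡.sym (half+half ε)))
             (ℚP.≤-trans (ε≤x n (⊔-left {M} h))
               (ℚP.<⇒≤ (near (seq x n) (seq y n) (ε * ½) (close n (⊔-right {M} h))))))))

  ¬positive-0 : ¬ Positive 0ℝ
  ¬positive-0 (mkPos (ε , 0<ε , N , ε≤0)) =
    ℚP.<-irrefl ≡.refl (ℚP.<-≤-trans 0<ε
      (≡.subst (ℚ._≤ 0ℚ) (ℚP.+-identityˡ ε) (ε≤0 N ℕP.≤-refl)))

  positive-1 : Positive 1ℝ
  positive-1 = mkPos (1ℚ , ℚP.positive⁻¹ 1ℚ , 0 , λ _ _ → ℚP.≤-reflexive (ℚP.+-identityˡ 1ℚ))

  positive-+ : ∀ {x y} → Positive x → Positive y → Positive (x +ℝ y)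
  positive-+ {x} {y} (mkPos (ε , 0<ε , M , ε≤x)) (mkPos (δ , 0<δ , N , δ≤y)) =
    mkPos (ε + δ , ≡.subst (ℚ._< ε + δ) (ℚP.+-identityˡ 0ℚ) (ℚP.+-mono-< 0<ε 0<δ) , M ℕ.⊔ N ,
      λ n h → ≡.subst (ℚ._≤ seq x n + seq y n) (zeros ε δ)
        (ℚP.+-mono-≤ (ε≤x n (⊔-left {M} h)) (δ≤y n (⊔-right {M} h))))
    where
    zeros : ∀ ε δ → (0ℚ + ε) + (0ℚ + δ) ≡ 0ℚ + (ε + δ)
    zeros = solve 2 (λ ε δ → (con 0ℚ :+ ε) :+ (con 0ℚ :+ δ) := con 0ℚ :+ (ε :+ δ)) ≡.refl
      where open ℚSolver.+-*-Solver

  positive-* : ∀ {x y} → Positive x → Positive y → Positive (x *ℝ y)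
  positive-* {x} {y} (mkPos (ε , 0<ε , M , ε≤x)) (mkPos (δ , 0<δ , N , δ≤y)) =
    mkPos (ε * δ , pos-* 0<ε 0<δ , M ℕ.⊔ N , λ n h →
      let ε≤xₙ = ≡.subst (ℚ._≤ seq x n) (ℚP.+-identityˡ ε) (ε≤x n (⊔-left {M} h))
          δ≤yₙ = ≡.subst (ℚ._≤ seq y n) (ℚP.+-identityˡ δ) (δ≤y n (⊔-right {M} h))
      in ≡.subst (ℚ._≤ seq x n * seq y n) (≡.sym (ℚP.+-identityˡ (ε * δ)))
           (ℚP.≤-trans (mono-*ˡ ε (ℚP.<⇒≤ 0<ε) δ≤yₙ)
             (mono-*ʳ (seq y n) (ℚP.≤-trans (ℚP.<⇒≤ 0<δ) δ≤yₙ) ε≤xₙ)))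

  recip-pos-inverse : ∀ x (0<x : 0ℝ <ℝ x) → x *ℝ recip-pos x 0<x ≃ 1ℝ
  recip-pos-inverse x (e , 0<e , N , e≤x) = mk≃ λ ε 0<ε → N , λ n N≤n →
    let e≤xₙ = ≡.subst (ℚ._≤ seq x n) (ℚP.+-identityˡ e) (e≤x n N≤n)
        one : seq x n * recip-seq 0<e (seq x) n ≡ 1ℚ
        -- From index `N` on the truncation `e ⊔ seq x n` equals `seq x n`, so the product is
        -- exactly 1.
        one = ≡.trans (≡.cong (_* recip-seq 0<e (seq x) n) (≡.sym (ℚP.p≤q⇒p⊔q≡q e≤xₙ)))
                (inv-r (<-≤-pos 0<e (seq x n)))
    in ≡.subst (λ z → ∣ z - 1ℚ ∣ ℚ.< ε) (≡.sym one) 0<ε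

  recip-pos-positive : ∀ x (0<x : 0ℝ <ℝ x) → Positive (recip-pos x 0<x)
  recip-pos-positive x (e , 0<e , N , e≤x) =
    let K , 0<K , M , x≤K = bounded x
        e⊔K>0 = <-≤-pos 0<e K
    in mkPos (inv e⊔K>0 , inv-pos e⊔K>0 , M , λ n M≤n →
         ≡.subst (ℚ._≤ recip-seq 0<e (seq x) n) (≡.sym (ℚP.+-identityˡ (inv e⊔K>0)))
           (inv-anti (<-≤-pos 0<e (seq x n)) e⊔K>0
             (ℚP.⊔-monoʳ-≤ e (ℚP.≤-trans (p≤∣p∣ (seq x n)) (x≤K n M≤n)))))

open RealNumbers using
  (pointwise; ℝ-commutativeRing; positive-resp; ¬positive-0; positive-1; positive-+; positive-*;
   positive-cotrans; ¬positive⇒≃0; recip-pos-inverse; recip-pos-positive)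

ℝ-orderedField : OrderedFieldOverℚ
ℝ-orderedField = record
  { commutativeRing = ℝ-commutativeRing
  ; ι           = fromℚ
  ; ι-+         = λ _ _ → pointwise λ _ → ≡.refl
  ; ι-*         = λ _ _ → pointwise λ _ → ≡.refl
  ; ι-neg       = λ _ → pointwise λ _ → ≡.refl
  ; ι-0         = pointwise λ _ → ≡.refl
  ; ι-1         = pointwise λ _ → ≡.refl
  ; Pos         = Positive
  ; pos-resp    = positive-resp
  ; ¬pos-0      = ¬positive-0
  ; pos-1       = positive-1
  ; +-pos       = positive-+
  ; *-pos       = positive-*
  ; pos-cotrans = positive-cotrans
  ; tight       = ¬positive⇒≃0
  ; inverse     = λ {x} (mkPos 0<x) →
      recip-pos x 0<x , recip-pos-positive x 0<x , recip-pos-inverse x 0<x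
  }

open OrderedFieldOverℚ ℝ-orderedField
  using (refl; sym; trans; +-cong; +-comm; -‿cong; +-congˡ; *-congˡ; *-congʳ;
         *-identityˡ; *-identityʳ; +-identityʳ; zeroˡ; zeroʳ; -‿inverseʳ;
         reflexive; pos-resp; *-pos)
open OrderedField ℝ-orderedField
open RationalSpans ℝ-orderedField
open IntegerAction ℝ-orderedField
open ≈-Reasoning hiding (start)

-- Order

<⇒positive : ∀ {x y} → x <ℝ y → Positive (y -ℝ x)
<⇒positive {x} {y} (ε , 0<ε , N , x+ε≤y) = mkPos (ε , 0<ε , N , λ n N≤n →
  ≡.subst (ℚ._≤ seq y n ℚ.- seq x n) (eq (seq x n) ε)
    (ℚP.+-monoˡ-≤ (ℚ.- seq x n) (x+ε≤y n N≤n)))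
  where
  eq : ∀ a e → a ℚ.+ e ℚ.- a ≡ 0ℚ ℚ.+ e
  eq = S.solve 2 (λ a e → a S.:+ e S.:- a S.:= S.con 0ℚ S.:+ e) ≡.refl
    where module S = ℚSolver.+-*-Solver

positive⇒< : ∀ {x y} → Positive (y -ℝ x) → x <ℝ y
positive⇒< {x} {y} (mkPos (ε , 0<ε , N , ε≤y-x)) = ε , 0<ε , N , λ n N≤n →
  ≡.subst₂ ℚ._≤_ (eq₁ (seq x n) ε) (eq₂ (seq x n) (seq y n))
    (ℚP.+-monoˡ-≤ (seq x n) (ε≤y-x n N≤n))
  where
  module S = ℚSolver.+-*-Solver
  eq₁ : ∀ a e → 0ℚ ℚ.+ e ℚ.+ a ≡ a ℚ.+ e
  eq₁ = S.solve 2 (λ a e → S.con 0ℚ S.:+ e S.:+ a S.:= a S.:+ e) ≡.refl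
  eq₂ : ∀ a b → b ℚ.- a ℚ.+ a ≡ b
  eq₂ = S.solve 2 (λ a b → b S.:- a S.:+ a S.:= b) ≡.refl

≤⇒nonneg : ∀ {x y} → x ≤ℝ y → Nonneg (y -ℝ x)
≤⇒nonneg {x} {y} x≤y = ¬pos⇒nonneg {x} {y} (x≤y ∘ positive⇒< {y} {x})

nonneg⇒≤ : ∀ {x y} → Nonneg (y -ℝ x) → x ≤ℝ y
nonneg⇒≤ {x} {y} y-x≥0 y<x = y-x≥0
  (pos-resp (solve 2 (λ x y → x :- y := :- (y :- x)) refl x y) (<⇒positive {y} {x} y<x))

#0⇒square-positive : ∀ {x} → x #ℝ 0ℝ → Positive (x *ℝ x)
#0⇒square-positive {x} (inj₁ x<0) = pos-resp (pointwise λ n → eq (seq x n))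
  (*-pos (<⇒positive {x} {0ℝ} x<0) (<⇒positive {x} {0ℝ} x<0))
  where
  module S = ℚSolver.+-*-Solver
  eq : ∀ x → (0ℚ ℚ.- x) ℚ.* (0ℚ ℚ.- x) ≡ x ℚ.* x
  eq = S.solve 1 (λ x → (S.con 0ℚ S.:- x) S.:* (S.con 0ℚ S.:- x) S.:= x S.:* x) ≡.refl
#0⇒square-positive (inj₂ 0<x) = *-pos (mkPos 0<x) (mkPos 0<x)

recip-inverse : ∀ x (x#0 : x #ℝ 0ℝ) → x *ℝ recip x x#0 ≃ 1ℝ
recip-inverse x (inj₂ 0<x) = recip-pos-inverse x 0<x
recip-inverse x (inj₁ (e , 0<e , N , x<0)) = trans
  (solve 2 (λ x y → x :* (:- y) := (:- x) :* y) refl x (recip-pos (-ℝ x) 0<-x))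
  (recip-pos-inverse (-ℝ x) 0<-x)
  where
  0<-x : 0ℝ <ℝ -ℝ x
  0<-x = e , 0<e , N , λ n N≤n → neg-pos-swap (x<0 n N≤n)

inverse-unique : ∀ {x y z} → x *ℝ y ≃ 1ℝ → x *ℝ z ≃ 1ℝ → y ≃ z
inverse-unique {x} {y} {z} xy≃1 xz≃1 = begin
  y             ≈⟨ trans (sym (*-identityʳ y)) (*-congˡ {y} (sym xz≃1)) ⟩
  y *ℝ (x *ℝ z) ≈⟨ solve 3 (λ x y z → y :* (x :* z) := (x :* y) :* z) refl x y z ⟩
  x *ℝ y *ℝ z   ≈⟨ trans (*-congʳ {z} xy≃1) (*-identityˡ z) ⟩
  z             ∎

*-÷-cancel : ∀ x y (y#0 : y #ℝ 0ℝ) → y *ℝ (x ÷ℝ y [ y#0 ]) ≃ x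
*-÷-cancel x y y#0 = begin
  y *ℝ (x *ℝ recip y y#0) ≈⟨ solve 3 (λ x y z → y :* (x :* z) := x :* (y :* z)) refl x y (recip y y#0) ⟩
  x *ℝ (y *ℝ recip y y#0) ≈⟨ *-congˡ {x} (recip-inverse y y#0) ⟩
  x *ℝ 1ℝ                 ≈⟨ *-identityʳ x ⟩
  x                       ∎

-- Eigenvalues

re-sum : ∀ {d} (t : Vector ℂ d) → re (sumℂ t) ≡ sum (re ∘ t)
re-sum {zero}  t = ≡.refl
re-sum {suc d} t = ≡.cong (re (t zero) +ℝ_) (re-sum (t ∘ suc))

im-sum : ∀ {d} (t : Vector ℂ d) → im (sumℂ t) ≡ sum (im ∘ t)
im-sum {zero}  t = ≡.refl
im-sum {suc d} t = ≡.cong (im (t zero) +ℝ_) (im-sum (t ∘ suc))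

x-0*y : ∀ x y → x -ℝ 0ℝ *ℝ y ≃ x
x-0*y x y = trans (solve 3 (λ x y z → x :- z :* y := x :+ z :* (:- y)) refl x y 0ℝ)
  (trans (+-congˡ {x} (zeroˡ (-ℝ y))) (+-identityʳ x))

x+0*y : ∀ x y → x +ℝ 0ℝ *ℝ y ≃ x
x+0*y x y = trans (+-congˡ {x} (zeroˡ y)) (+-identityʳ x)

re-· : ∀ {d} (M : Matrix ℤ d) v i → re ((M · v) i) ≃ (M • (re ∘ v)) i
re-· M v i = trans (reflexive (re-sum λ j → fromℝ (fromℤ (M i j)) *ℂ v j))
  (sum-cong-≋ λ j → x-0*y (fromℤ (M i j) *ℝ re (v j)) (im (v j)))

im-· : ∀ {d} (M : Matrix ℤ d) v i → im ((M · v) i) ≃ (M • (im ∘ v)) i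
im-· M v i = trans (reflexive (im-sum λ j → fromℝ (fromℤ (M i j)) *ℂ v j))
  (sum-cong-≋ λ j → x+0*y (fromℤ (M i j) *ℝ im (v j)) (re (v j)))

module _ {d} {M : Matrix ℤ (suc d)} {w : Vector ℝ (suc d)} (w₀≃1 : w zero ≃ 1ℝ) where

  real-eigenvalue : ∀ {ρ} → (∀ i → (M • w) i ≃ ρ *ℝ w i) → IsEigenvalue M (fromℝ ρ)
  real-eigenvalue {ρ} Mw = fromℝ ∘ w ,
    (zero , inj₁ (inj₂ (getPos (pos-resp (sym w₀≃1) positive-1)))) , λ i →
      get≃ (trans (re-· M (fromℝ ∘ w) i) (trans (Mw i) (sym (x-0*y (ρ *ℝ w i) 0ℝ)))) ,
      get≃ (trans (im-· M (fromℝ ∘ w) i) (trans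
        (sum-cong-≋ λ j → zeroʳ (fromℤ (M i j))) (trans (sum-replicate-zero (suc d))
        (sym (trans (x+0*y (ρ *ℝ 0ℝ) (w i)) (zeroʳ ρ))))))

  module _ {σ : ℝ} (M-nat : NatMatrix M) (w>0 : ∀ i → Positive (w i)) (σ>0 : Positive σ)
    (Mw : ∀ i → (M • w) i ≃ σ *ℝ w i) where

    ∣eigenvalue∣≤σ : ∀ μ → IsEigenvalue M μ → Nonneg (σ *ℝ σ -ℝ ∣ μ ∣²)
    ∣eigenvalue∣≤σ μ (v , (i₀ , vᵢ#0) , Mv) =
      eigenvalue-bound (λ i j → nonneg-ιℤ (M-nat i j)) w>0 Mw
        {u = re ∘ v} {v = im ∘ v}
        (λ i → trans (sym (re-· M v i)) (mk≃ (proj₁ (Mv i))))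
        (λ i → trans (sym (im-· M v i)) (mk≃ (proj₂ (Mv i))))
        (i₀ , nonzero vᵢ#0)
      where
      nonzero : NonZeroℂ (v i₀) → Positive (norm² (re (v i₀)) (im (v i₀)))
      nonzero (inj₁ x#0) = pos+nonneg (#0⇒square-positive x#0) (nonneg-square (im (v i₀)))
      nonzero (inj₂ y#0) = pos-resp (+-comm (im (v i₀) *ℝ im (v i₀)) (re (v i₀) *ℝ re (v i₀)))
        (pos+nonneg (#0⇒square-positive y#0) (nonneg-square (re (v i₀))))

    ∣σ∣² : ∣ fromℝ σ ∣² ≃ σ *ℝ σ
    ∣σ∣² = x+0*y (σ *ℝ σ) 0ℝ

    positive-eigenvector⇒spectralRadius : IsSpectralRadius M σ
    positive-eigenvector⇒spectralRadius =
      nonneg⇒≤ {0ℝ} {σ} (nonneg-resp (sym (pointwise λ n → ℚP.+-identityʳ (seq σ n))) (pos⇒nonneg σ>0)) ,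
      (λ μ eigen → nonneg⇒≤ {∣ μ ∣²} {σ *ℝ σ} (∣eigenvalue∣≤σ μ eigen)) ,
      fromℝ σ , real-eigenvalue Mw , get≃ ∣σ∣²

    -- σ is an eigenvalue, so σ² ≤ ρ²; conversely ρ is attained by some eigenvalue μ, and ∣μ∣² ≤ σ²
    -- by comparison with the positive eigenvector. Both numbers are nonnegative, so equal squares
    -- suffice.
    spectralRadius-unique : ∀ {ρ} → IsSpectralRadius M ρ → σ ≃ ρ
    spectralRadius-unique {ρ} (0≤ρ , bound , μ , eigen , ∣μ∣²≈ρ²) = squares-equal σ>0
      (nonneg-resp (pointwise λ n → ℚP.+-identityʳ (seq ρ n)) (≤⇒nonneg {0ℝ} {ρ} 0≤ρ))
      (nonneg-resp (+-congˡ {ρ *ℝ ρ} (-‿cong ∣σ∣²))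
        (≤⇒nonneg {∣ fromℝ σ ∣²} {ρ *ℝ ρ} (bound (fromℝ σ) (real-eigenvalue Mw))))
      (nonneg-resp (+-congˡ {σ *ℝ σ} (-‿cong (mk≃ ∣μ∣²≈ρ²))) (∣eigenvalue∣≤σ μ eigen))

-- The field ℚ(ρ)

ℚ⟨⟩-isSubfield : ∀ ρ → IsSubfield ℚ⟨ ρ ⟩
ℚ⟨⟩-isSubfield ρ = record
  { isSubring = record
    { K-resp = resp ∘ get≃ ; K-ι = rat ; K-+ = add ; K-neg = neg ; K-* = mul }
  ; K-inv = λ {x} (mkPos 0<x) xy≃1 x∈K →
      resp (get≃ (inverse-unique {x} (recip-inverse x (inj₂ 0<x)) xy≃1)) (inv# (inj₂ 0<x) x∈K)
  }

module _ {d} {M : Matrix ℤ (suc d)} {w : Vector ℝ (suc d)} {ρ : ℝ} (w₀≃1 : w zero ≃ 1ℝ)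
  (Mw : ∀ i → (M • w) i ≃ ρ *ℝ w i) where

  private
    K : ℝ → Set
    K z = ℚ[ρ] ρ z × Multiplier w z

    K-isSubring : IsSubring K
    K-isSubring = ∩-isSubring (ℚ[ρ]-isSubring ρ) (multiplier-isSubring w)

    open IsSubring K-isSubring

  -- Both properties go through one induction because of `inv#`: the multiplier half supplies a
  -- rational relation between the powers of `y`, which expresses the inverse as a polynomial in
  -- `y`, and so the inverse inherits both halves.
  ℚ⟨⟩⇒polynomial×multiplier : ∀ {z} → ℚ⟨ ρ ⟩ z → ℚ[ρ] ρ z × Multiplier w z
  ℚ⟨⟩⇒polynomial×multiplier (resp y≈z y∈) = K-resp (mk≃ y≈z) (ℚ⟨⟩⇒polynomial×multiplier y∈)
  ℚ⟨⟩⇒polynomial×multiplier (rat q)       = K-ι q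
  ℚ⟨⟩⇒polynomial×multiplier gen           =
    -- Row `i` of `M` lists the rational coordinates of `ρ *ℝ w i`.
    ℚ[ρ]-generator ρ , λ i → toℚ ∘ M i , sym (Mw i)
  ℚ⟨⟩⇒polynomial×multiplier (add y∈ z∈)   =
    K-+ (ℚ⟨⟩⇒polynomial×multiplier y∈) (ℚ⟨⟩⇒polynomial×multiplier z∈)
  ℚ⟨⟩⇒polynomial×multiplier (neg y∈)      = K-neg (ℚ⟨⟩⇒polynomial×multiplier y∈)
  ℚ⟨⟩⇒polynomial×multiplier (mul y∈ z∈)   =
    K-* (ℚ⟨⟩⇒polynomial×multiplier y∈) (ℚ⟨⟩⇒polynomial×multiplier z∈)
  ℚ⟨⟩⇒polynomial×multiplier (inv# {y} y#0 y∈) =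
    inverse-of-multiplier K-isSubring {w = w} {zero} w₀≃1
      (proj₂ (ℚ⟨⟩⇒polynomial×multiplier y∈)) (ℚ⟨⟩⇒polynomial×multiplier y∈) (recip-inverse y y#0)

  ℚ⟨⟩⇒inSpan : ∀ {z} → ℚ⟨ ρ ⟩ z → InSpan w z
  ℚ⟨⟩⇒inSpan {z} z∈ = span-resp {w = w} (trans (*-congˡ {z} w₀≃1) (*-identityʳ z))
    (proj₂ (ℚ⟨⟩⇒polynomial×multiplier z∈) zero)

  ℚ⟨⟩⇒rationalFunction : ∀ {z} → ℚ⟨ ρ ⟩ z → IsRationalFunctionOf ρ z
  -- Elements of ℚ(ρ) are already polynomials in ρ, so the constant denominator 1 will do.
  ℚ⟨⟩⇒rationalFunction {z} z∈ = P , 1ℚ ∷ [] , Q#0 , get≃ (begin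
      z
        ≈⟨ z≃P ⟩
      evaluate ρ P
        ≈⟨ evaluate≃eval P ⟩
      eval P ρ
        ≈⟨ *-÷-cancel (eval P ρ) Q Q#0 ⟨
      Q *ℝ (eval P ρ ÷ℝ Q [ Q#0 ])
        ≈⟨ trans (*-congʳ {eval P ρ ÷ℝ Q [ Q#0 ]} Q≃1) (*-identityˡ _) ⟩
      (eval P ρ ÷ℝ Q [ Q#0 ]) ∎)
    where
    P : List ℚ
    P = proj₁ (proj₁ (ℚ⟨⟩⇒polynomial×multiplier z∈))
    z≃P : z ≃ evaluate ρ P
    z≃P = proj₂ (proj₁ (ℚ⟨⟩⇒polynomial×multiplier z∈))
    evaluate≃eval : ∀ P → evaluate ρ P ≃ eval P ρ
    evaluate≃eval []      = refl
    evaluate≃eval (c ∷ P) = +-congˡ {fromℚ c} (*-congˡ {ρ} (evaluate≃eval P))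
    Q : ℝ
    Q = eval (1ℚ ∷ []) ρ
    Q≃1 : Q ≃ 1ℝ
    Q≃1 = trans (+-congˡ {1ℝ} (zeroʳ ρ)) (+-identityʳ 1ℝ)
    Q#0 : Q #ℝ 0ℝ
    Q#0 = inj₂ (getPos (pos-resp (sym Q≃1) positive-1))

  -- `w` itself is the spanning family. A basis with more elements than `w` would lie in the span of
  -- `w` and hence be dependent.
  degreeAtMost : (∀ i → ℚ⟨ ρ ⟩ (w i)) → DegreeAtMost ρ (suc d)
  degreeAtMost w∈ =
    (w , w∈ , λ y y∈ → let q , y≃ = ℚ⟨⟩⇒inSpan y∈ in q , get≃ y≃) ,
    λ e (b , (b∈ , _) , independent) → ℕP.≮⇒≥ λ d<e →
      let c , (i , cᵢ≢0) , relation = spanned-dependent {w = w} d<e b (ℚ⟨⟩⇒inSpan ∘ b∈)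
      in cᵢ≢0 (independent c (get≃ relation) i)

-- Selmer expansions

coordinates-positive : ∀ {r} (x : Vector ℝ (suc r)) →
  (∀ (i : Fin r) → x (suc i) ≤ℝ x (inject₁ i)) → 0ℝ <ℝ last x → ∀ i → 0ℝ <ℝ x i
coordinates-positive x dec pos zero = head-pos-chain x dec pos
coordinates-positive {suc r} x dec pos (suc i) =
  coordinates-positive (tail x) (dec ∘ suc) pos i

last≤head : ∀ {r} (x : Vector ℝ (suc r)) →
  (∀ (i : Fin r) → x (suc i) ≤ℝ x (inject₁ i)) → Nonneg (head x -ℝ last x)
last≤head {zero}  x dec = nonneg-resp (sym (-‿inverseʳ (x zero))) nonneg-0
last≤head {suc r} x dec = nonneg-resp
  (solve 3 (λ a b c → (a :- b) :+ (b :- c) := a :- c) refl (x zero) (x (suc zero)) (last x))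
  (nonneg+nonneg (≤⇒nonneg {x (suc zero)} {x zero} (dec zero)) (last≤head (tail x) (dec ∘ suc)))

snoc-inject₁ : ∀ {A : Set} {d} (v : Vector A d) a i → snoc v a (inject₁ i) ≡ v i
snoc-inject₁ {d = suc d} v a zero    = ≡.refl
snoc-inject₁ {d = suc d} v a (suc i) = snoc-inject₁ (tail v) a i

snoc-last : ∀ {A : Set} {d} (v : Vector A d) a → snoc v a (fromℕ d) ≡ a
snoc-last {d = zero}  v a = ≡.refl
snoc-last {d = suc d} v a = snoc-last (tail v) a

module _ {r} {x : B r} (E : Expansion x) where

  y : ℕ → Vector ℝ (suc r)
  y j = pt (iter E j)

  homogeneous : ℕ → Vector ℝ (suc (suc r))
  homogeneous j = 1ℝ ∷ᵛ y j

  homogeneous-positive : ∀ j i → Positive (homogeneous j i)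
  homogeneous-positive j zero    = positive-1
  homogeneous-positive j (suc i) =
    mkPos (coordinates-positive (y j) (decreasing (iter E j)) (positive E j) i)

  head*S : ∀ j i → head (y j) *ℝ y (suc j) i ≃
    snoc (tail (y j)) (1ℝ -ℝ fromNat (digit E (suc j)) *ℝ last (y j)) i
  head*S j i = trans (*-congˡ {head (y j)} (mk≃ (step E j i)))
    (*-÷-cancel (snoc (tail (y j)) (1ℝ -ℝ fromNat (digit E (suc j)) *ℝ last (y j)) i) (head (y j))
      (inj₂ (head-pos (iter E j) (positive E j))))

  shift : ∀ j i → head (y j) *ℝ homogeneous (suc j) (inject₁ i) ≃ y j i
  shift j zero    = *-identityʳ (head (y j))
  shift j (suc i) = trans (head*S j (inject₁ i)) (reflexive (snoc-inject₁ (tail (y j)) _ i))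

  -- In homogeneous coordinates (1, y) the matrix β undoes one Selmer step up to the factor y₁. The
  -- lower rows undo the shift of coordinates, and row 0 restores the leading 1 as k yₙ + (1 - k
  -- yₙ).
  β-step : ∀ j i →
    head (y j) *ℝ (β (digit E (suc j)) • homogeneous (suc j)) i ≃ homogeneous j i
  β-step j (suc i) = trans
    (*-congˡ {head (y j)} (β-•-suc (digit E (suc j)) (homogeneous (suc j)) i)) (shift j i)
  β-step j zero = begin
    h *ℝ (β k • v) zero
      ≈⟨ *-congˡ {h} (β-•-zero k v) ⟩
    h *ℝ (fromNat k *ℝ v (inject₁ (fromℕ r)) +ℝ v (fromℕ (suc r)))
      ≈⟨ solve 4 (λ h k a b → h :* (k :* a :+ b) := k :* (h :* a) :+ h :* b) refl
           h (fromNat k) (v (inject₁ (fromℕ r))) (v (fromℕ (suc r))) ⟩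
    fromNat k *ℝ (h *ℝ v (inject₁ (fromℕ r))) +ℝ h *ℝ v (fromℕ (suc r))
      ≈⟨ +-cong (*-congˡ {fromNat k} (shift j (fromℕ r)))
           (trans (head*S j (fromℕ r)) (reflexive (snoc-last (tail (y j)) _))) ⟩
    fromNat k *ℝ last (y j) +ℝ (1ℝ -ℝ fromNat k *ℝ last (y j))
      ≈⟨ solve 2 (λ a b → a :+ (b :- a) := b) refl (fromNat k *ℝ last (y j)) 1ℝ ⟩
    1ℝ ∎
    where
    k : ℕ
    k = digit E (suc j)
    h : ℝ
    h = head (y j)
    v : Vector ℝ (suc (suc r))
    v = homogeneous (suc j)

  -- A digit 0 would mean 1 / yₙ < 1, hence yₙ > 1, against yₙ ≤ y₁ ≤ 1. Positive digits are what
  -- makes the edge `penultimate` available at every step.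
  digit-positive : ∀ j → ∃[ a ] digit E (suc j) ≡ suc a
  digit-positive j with digit E (suc j) | digit-floor E j
  ... | suc a | _             = a , ≡.refl
  ... | zero  | _ , 1/last<1 = contradiction
    (pos-resp
      (trans
        (solve 3 (λ l q e → l :* (e :- q) := l :* e :- l :* q) refl (last (y j)) q 1ℝ)
        (trans (+-cong (*-identityʳ (last (y j)))
          (-‿cong (*-÷-cancel 1ℝ (last (y j)) (inj₂ (positive E j)))))
          (solve 2 (λ l e → l :- e := :- (e :- l)) refl (last (y j)) 1ℝ)))
      (*-pos (mkPos (positive E j)) (<⇒positive {q} {1ℝ} 1/last<1)))
    (nonneg-resp
      (solve 3 (λ a b c → (a :- b) :+ (b :- c) := a :- c) refl 1ℝ (head (y j)) (last (y j)))
      (nonneg+nonneg (≤⇒nonneg {head (y j)} {1ℝ} (head≤1 (iter E j)))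
        (last≤head (y j) (decreasing (iter E j)))))
    where
    q : ℝ
    q = 1ℝ ÷ℝ last (y j) [ inj₂ (positive E j) ]

open import Data.Nat.Base using (_+_; _≤_)

mainTheorem6 : ∀ {r : ℕ} (x : B r) (E : Expansion x) (m p : ℕ) → 1 ≤ p →
    pt (iter E (m + p)) ≈ᵛ pt (iter E m) →
    let βᵖ = periodMatrix {r} (digit E) m p in
    (∃[ ρ₀ ] IsSpectralRadius βᵖ ρ₀) ×
    (∀ ρ₀ → IsSpectralRadius βᵖ ρ₀ →
    0ℝ <ℝ ρ₀ × IsEigenvalue βᵖ (fromℝ ρ₀) ×
    (∀ i → IsRationalFunctionOf ρ₀ (pt x i)) ×
    (∀ i → ℚ⟨ ρ₀ ⟩ (pt x i)) ×
    DegreeAtMost ρ₀ (suc (suc r)))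
mainTheorem6 {r} x E m (suc p′) 1≤p periodic =
  (σ , positive-eigenvector⇒spectralRadius refl M-nat w>0 σ>0 Mw) ,
  λ ρ radius →
    -- Any spectral radius ρ agrees with σ only up to `_≃_`, so the eigenvector equation and
    -- positivity are moved to ρ before fields generated by ρ itself are considered.
    let σ≃ρ : σ ≃ ρ
        σ≃ρ = spectralRadius-unique refl M-nat w>0 σ>0 Mw radius
        Mw′ : ∀ i → (M • w) i ≃ ρ *ℝ w i
        Mw′ i = trans (Mw i) (*-congʳ {w i} σ≃ρ)
        ρ>0 : Positive ρ
        ρ>0 = pos-resp σ≃ρ σ>0
        w∈ : ∀ i → ℚ⟨ ρ ⟩ (w i)
        w∈ = period-eigenvector-in-subfield (ℚ⟨⟩-isSubfield ρ) (digit-positive E) m p′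
               w>0 refl ρ>0 gen Mw′
        x∈ : ∀ i → ℚ⟨ ρ ⟩ (pt x i)
        -- The index `suc i` skips the homogenising coordinate 1, and `start` passes from the zeroth
        -- iterate to `x`.
        x∈ i = resp (start E i)
          (K-backwards {k = digit E} {v = homogeneous E} heads>0 (β-step E)
            (ℚ⟨⟩-isSubfield ρ) (λ _ → refl) m w∈ (suc i))
    in getPos ρ>0 , real-eigenvalue {M = M} refl Mw′ ,
       (λ i → ℚ⟨⟩⇒rationalFunction {M = M} refl Mw′ (x∈ i)) , x∈ ,
       degreeAtMost {M = M} refl Mw′ w∈
  where
  M : Matrix ℤ (suc (suc r))
  M = periodMatrix (digit E) m (suc p′)
  M-nat : NatMatrix M
  M-nat = nat-periodMatrix (digit E) m (suc p′)
  w : Vector ℝ (suc (suc r))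
  w = homogeneous E m
  w>0 : ∀ i → Positive (w i)
  w>0 = homogeneous-positive E m
  heads>0 : ∀ j → Positive (head (pt (iter E j)))
  heads>0 j = homogeneous-positive E j (suc zero)
  eigenpair : ∃[ σ ] Positive σ × (∀ i → (M • w) i ≃ σ *ℝ w i)
  eigenpair = periodic-eigenvalue {v = homogeneous E} heads>0 (β-step E) m (suc p′) λ where
    zero    → refl
    (suc i) → mk≃ (periodic i)
  σ : ℝ
  σ = proj₁ eigenpair
  σ>0 : Positive σ
  σ>0 = proj₁ (proj₂ eigenpair)
  Mw : ∀ i → (M • w) i ≃ σ *ℝ w i
  Mw = proj₂ (proj₂ eigenpair)
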